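{- Let $G=(V,E)$ be a finite DAG with maxoid polytope $P_G$. The vertices of $P_G$ are in one-to-one correspondence with the generic maxoids of $G$: a vertex $v$ corresponds to the maxoid $\mathcal{M}_*(G,C)$ of the weight matrices $C$ in the interior of the normal cone $N_v$. The faces $F$ of $P_G$ of dimension at least $1$ correspond to non-generic maxoids, i.e. to the maxoids $\mathcal{M}_*(G,C)$ of the non-generic weight matrices $C$, with $C$ in the relative interior of the normal cone $N_F$.
   Context: Let $G=(V,E)$ be a finite DAG. $\mathbb{R}^E$ denotes the set of weight matrices supported on $G$: $V\times V$ matrices $C=(c_{ij})$ with $c_{ij}\in\mathbb{R}$ if $i\to j\in E$ and $c_{ij}=-\infty$ otherwise (identified with the Euclidean space indexed by $E$). For distinct $i,j\in V$, $P(i,j)$ is the set of directed paths from $i$ to $j$ in $G$, and the weight of a path $\pi$ is $\omega_C(\pi)=\sum_{e\in\pi}c_e$. A path in $P(i,j)$ is critical (for $(G,C)$) if its weight is maximal among all paths in $P(i,j)$. $C$ is generic if for all distinct $i,j$ with $P(i,j)\ne\emptyset$ there is exactly one critical path from $i$ to $j$. For $L\subseteq V$, the critical DAG $G^*_{C,L}$ is the DAG on $V$ with an edge $i\to j$ ($i\neq j$) if and only if $P(i,j)\neq\emptyset$ and no critical path from $i$ to $j$ in $(G,C)$ has an interior node in $L$. Distinct $i,j\in V\setminus L$ are $C^*$-connected given $L$ if $G^*_{C,L}$ contains, up to exchanging $i$ and $j$, a path of one of the forms (a) $i\to j$; (b) $i\leftarrow p\to j$; (c) $i\to \ell\leftarrow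 j$; (d) $i\leftarrow p\to\ell\leftarrow j$; (e) $i\leftarrow p\to\ell\leftarrow q\to j$, with $\ell\in L$ and $p,q\notin L$. Otherwise they are $C^*$-separated given $L$. For pairwise disjoint $I,J,L\subseteq V$, $I$ and $J$ are $C^*$-separated given $L$ if every $i\in I$ and $j\in J$ are $C^*$-separated given $L$. The maxoid $\mathcal{M}_*(G,C)$ is the set of all triples (CI statements) $[I\perp\!\!\!\perp J\mid L]$ with $I,J,L$ pairwise disjoint such that $I$ and $J$ are $C^*$-separated given $L$ in $(G,C)$. It is called a generic maxoid of $G$ if it arises from a generic $C$, and a non-generic maxoid if it arises from a non-generic $C$ (the same set of CI statements may be both). The path polynomial of a pair of distinct nodes $i,j$ with $|P(i,j)|\geq1$ is $f_{ij}=\sum_{\pi\in P(i,j)}\prod_{u\to v\in\pi}x_{uv}\in\mathbb{R}[x_{uv}:u\to v\in E]$. $\operatorname{Newt}(f)\subset\mathbb{R}^E$ is the convex hull of the exponent vectors of the terms of $f$. The maxoid polytope is the Minkowski sum $P_G=\sum_{|P(i,j)|\ge1}\operatorname{Newt}(f_{ij})$. The normal cone of a non-empty face $F$ of $P_G$ is $N_F=\{c\in\mathbb{R}^E:\langle c,x\rangle=\max_{y\in P_G}\langle c,y\rangle\text{ for all }x\in F\}$. -}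

module Defs where

open import Level using (0ℓ) renaming (suc to lsuc)
open import Algebra.Bundles using (CommutativeRing)
import Algebra.Definitions.RawMonoid as RawMonoidOps
open import Data.Bool.Base using (if_then_else_)
open import Data.Fin.Base using (Fin)
open import Data.Fin.Properties using (_≟_)
open import Data.Fin.Subset using (Subset; Empty; _∩_) renaming (_∈_ to _∈ₛ_; _∉_ to _∉ₛ_)
open import Data.List.Base using (List; []; _∷_; _++_; map; concatMap; filter; foldr; length; allFin; cartesianProduct)
import Data.List.Membership.Propositional as ListMembership
open import Data.Nat.Base as ℕ using (ℕ; zero; suc)
import Data.Nat.Properties as ℕₚ
open import Data.Product using (Σ; ∃; ∃!; _×_; _,_; proj₁)
open import Data.Sum.Base using (_⊎_)
open import Data.Vec.Base as Vec using (Vec; lookup; replicate; zipWith; tabulate)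
import Data.Vec.Properties as Vecₚ
open import Data.Vec.Functional using (Vector)
import Data.Vec.Functional.Relation.Binary.Equality.Setoid as VectorEquality
open import Relation.Binary.Bundles using (Setoid)
open import Relation.Binary.Construct.Closure.ReflexiveTransitive using (Star; ε; _◅_)
open import Relation.Binary.Construct.Closure.Transitive using (TransClosure)
import Relation.Binary.Construct.On as On
open import Relation.Binary.Core using (Rel)
open import Relation.Binary.PropositionalEquality.Core using (_≡_; _≢_; refl)
open import Relation.Binary.Structures using (IsDecTotalOrder)
open import Relation.Nullary using (¬_; yes; no; ¬?; _×-dec_; does)
open import Relation.Unary using (Pred; _∈_; _≐_; Satisfiable)
open import Relation.Unary.Relation.Binary.Equality using (≐-setoid)

-- The real numbers, axiomatised as a Dedekind-complete totally ordered field.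
-- Decidability of the order is part of the axioms: these are the classical
-- reals, for which x ≤ y or ¬ (x ≤ y) always holds.
record RealField : Set₁ where
  field
    commutativeRing : CommutativeRing 0ℓ 0ℓ
  open CommutativeRing commutativeRing public
  infix 4 _≤_
  field
    _≤_             : Rel Carrier 0ℓ
    isDecTotalOrder : IsDecTotalOrder _≈_ _≤_
    1≉0             : ¬ (1# ≈ 0#)
    inverse         : ∀ x → ¬ (x ≈ 0#) → ∃ λ y → x * y ≈ 1#
    +-monoˡ-≤       : ∀ z {x y} → x ≤ y → x + z ≤ y + z
    *-nonNegative   : ∀ {x y} → 0# ≤ x → 0# ≤ y → 0# ≤ x * y

  UpperBound : Pred Carrier 0ℓ → Pred Carrier 0ℓ
  UpperBound S u = ∀ x → x ∈ S → x ≤ u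

  field
    complete : (S : Pred Carrier 0ℓ) → Satisfiable S → Satisfiable (UpperBound S) →
               ∃ λ s → UpperBound S s × (∀ u → UpperBound S u → s ≤ u)

  infix 4 _<_
  _<_ : Rel Carrier 0ℓ
  x < y = x ≤ y × ¬ (x ≈ y)

-- The edge set E ⊆ V × V is given by an enumeration without repetitions,
-- so that ℝ^E is  Vector ℝ #E.
record DAG : Set where
  field
    #V #E         : ℕ
    source target : Fin #E → Fin #V
    simple        : ∀ {e e′} → source e ≡ source e′ → target e ≡ target e′ → e ≡ e′

  infix 4 _⟶_
  _⟶_ : Rel (Fin #V) 0ℓ
  i ⟶ j = ∃ λ e → source e ≡ i × target e ≡ j

  field
    acyclic : ∀ i → ¬ TransClosure _⟶_ i i

module Paths (G : DAG) where
  open DAG G public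

  V : Set
  V = Fin #V

  E : Set
  E = Fin #E

  -- In a DAG every walk is a path (no node is repeated). For i ≢ j this is
  -- P(i,j); for i ≡ j only the empty walk exists.
  P : Rel V 0ℓ
  P = Star _⟶_

  -- The nodes of a path other than its two endpoints.
  interiorNodes : ∀ {i j} → P i j → List V
  interiorNodes ε                           = []
  interiorNodes (_ ◅ ε)                     = []
  interiorNodes (_◅_ {j = k} _ ρ@(_ ◅ _)) = k ∷ interiorNodes ρ

  -- All paths with at most k edges, each listed once.
  pathsUpTo : ℕ → (i j : V) → List (P i j)
  emptyPath : (i j : V) → List (P i j)
  longerPaths : ℕ → (i j : V) → List (P i j)

  pathsUpTo zero    i j = emptyPath i j
  pathsUpTo (suc k) i j = emptyPath i j ++ longerPaths k i j

  emptyPath i j with i ≟ j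
  ... | yes refl = ε ∷ []
  ... | no  _    = []

  longerPaths k i j = concatMap via (allFin #E)
    where
    via : E → List (P i j)
    via e with source e ≟ i
    ... | yes s = map ((e , s , refl) ◅_) (pathsUpTo k (target e) j)
    ... | no  _ = []

  -- A path visits each node at most once, so it has fewer than #V edges and
  -- this list exhausts P i j.
  paths : (i j : V) → List (P i j)
  paths = pathsUpTo #V

  connectedPairs : List (V × V)
  connectedPairs =
    filter (λ (i , j) → ¬? (i ≟ j) ×-dec (1 ℕₚ.≤? length (paths i j)))
           (cartesianProduct (allFin #V) (allFin #V))

record CIStatement (n : ℕ) : Set where
  constructor [_⫫_∣_]
  field
    I J L : Subset n

module Convexity (ℝ : RealField) (d : ℕ) where
  open RealField ℝ
  open RawMonoidOps +-rawMonoid using (sum)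
  open VectorEquality setoid public using (_≋_; ≋-setoid)

  Space : Set
  Space = Vector Carrier d

  ⟨_,_⟩ : Space → Space → Carrier
  ⟨ c , x ⟩ = sum (λ e → c e * x e)

  linearCombination : ∀ {k} → Vector Carrier k → Vector Space k → Space
  linearCombination a p e = sum (λ s → a s * p s e)

  conv : Pred Space 0ℓ → Pred Space 0ℓ
  conv S x = ∃ λ k → Σ (Vector Carrier k) λ a → Σ (Vector Space k) λ p →
    (∀ s → p s ∈ S) × (∀ s → 0# ≤ a s) × sum a ≈ 1# × x ≋ linearCombination a p

  aff : Pred Space 0ℓ → Pred Space 0ℓ
  aff S x = ∃ λ k → Σ (Vector Carrier k) λ a → Σ (Vector Space k) λ p →
    (∀ s → p s ∈ S) × sum a ≈ 1# × x ≋ linearCombination a p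

  infixr 6 _⊕_
  _⊕_ : Pred Space 0ℓ → Pred Space 0ℓ → Pred Space 0ℓ
  (S ⊕ T) x = Σ Space λ s → Σ Space λ t → s ∈ S × t ∈ T × x ≋ (λ e → s e + t e)

  ｛0｝ : Pred Space 0ℓ
  ｛0｝ x = x ≋ (λ _ → 0#)

  minkowskiSum : List (Pred Space 0ℓ) → Pred Space 0ℓ
  minkowskiSum = foldr _⊕_ ｛0｝

  -- Interiors are taken in the Euclidean topology, via sup-norm balls.
  Ball : Space → Carrier → Pred Space 0ℓ
  Ball c r c′ = ∀ e → (- r < c′ e - c e) × (c′ e - c e < r)

  interior : Pred Space 0ℓ → Pred Space 0ℓ
  interior S c = ∃ λ r → 0# < r × (∀ c′ → c′ ∈ Ball c r → c′ ∈ S)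

  relativeInterior : Pred Space 0ℓ → Pred Space 0ℓ
  relativeInterior S c =
    c ∈ S × ∃ λ r → 0# < r × (∀ c′ → c′ ∈ aff S → c′ ∈ Ball c r → c′ ∈ S)

  -- v = max { ⟨ c , y ⟩ : y ∈ Q }
  IsMax : Space → Pred Space 0ℓ → Carrier → Set
  IsMax c Q v = (∃ λ y → y ∈ Q × ⟨ c , y ⟩ ≈ v) × (∀ y → y ∈ Q → ⟨ c , y ⟩ ≤ v)

  IsNonemptyFace : Pred Space 0ℓ → Pred Space 0ℓ → Set
  IsNonemptyFace Q F =
    Satisfiable F × ∃ λ c → F ≐ (λ x → x ∈ Q × IsMax c Q ⟨ c , x ⟩)

  singleton : Space → Pred Space 0ℓ
  singleton v x = x ≋ v

  IsVertex : Pred Space 0ℓ → Pred Space 0ℓ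
  IsVertex Q v = IsNonemptyFace Q (singleton v)

  AffinelyIndependent : ∀ {k} → Vector Space k → Set
  AffinelyIndependent {k} p = (a : Vector Carrier k) →
    sum a ≈ 0# → linearCombination a p ≋ (λ _ → 0#) → ∀ s → a s ≈ 0#

  -- dim S ≥ k, where dim S is the dimension of the affine hull of S.
  DimAtLeast : ℕ → Pred Space 0ℓ → Set
  DimAtLeast k S = Σ (Vector Space (suc k)) λ p →
    (∀ s → p s ∈ S) × AffinelyIndependent p

  normalCone : Pred Space 0ℓ → Pred Space 0ℓ → Pred Space 0ℓ
  normalCone Q F c = ∀ x → x ∈ F → IsMax c Q ⟨ c , x ⟩

module Polynomials (ℝ : RealField) (d : ℕ) where
  open RealField ℝ
  open RawMonoidOps +-rawMonoid renaming (_×_ to _·_) using ()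
  open Convexity ℝ d using (Space; conv; _≋_)

  Exponent : Set
  Exponent = Vec ℕ d

  Term : Set
  Term = Carrier × Exponent

  -- A formal sum of terms, in which the same exponent may occur repeatedly.
  Polynomial : Set
  Polynomial = List Term

  oneTerm : Term
  oneTerm = 1# , replicate d 0

  variableTerm : Fin d → Term
  variableTerm e = 1# , tabulate (λ e′ → if does (e ≟ e′) then 1 else 0)

  infixr 7 _⊗_
  _⊗_ : Term → Term → Term
  (a , u) ⊗ (b , v) = a * b , zipWith ℕ._+_ u v

  coefficient : Polynomial → Exponent → Carrier
  coefficient []            u = 0#
  coefficient ((a , v) ∷ f) u with Vecₚ.≡-dec ℕₚ._≟_ v u
  ... | yes _ = a + coefficient f u
  ... | no  _ = coefficient f u

  toPoint : Exponent → Space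
  toPoint u e = lookup u e · 1#

  Newt : Polynomial → Pred Space 0ℓ
  Newt f = conv λ x → ∃ λ u → ¬ (coefficient f u ≈ 0#) × x ≋ toPoint u

module Maxoids (ℝ : RealField) (G : DAG) where
  open RealField ℝ
  open Paths G
  open Convexity ℝ #E public
  open Polynomials ℝ #E
  open ListMembership using () renaming (_∈_ to _∈ₗ_)

  -- The finite entries of the weight matrix; the entry at a non-edge is -∞.
  WeightMatrix : Set
  WeightMatrix = Space

  weight : WeightMatrix → ∀ {i j} → P i j → Carrier
  weight C ε              = 0#
  weight C ((e , _) ◅ π) = C e + weight C π

  Critical : WeightMatrix → ∀ {i j} → Pred (P i j) 0ℓ
  Critical C {i} {j} π = (ρ : P i j) → weight C ρ ≤ weight C π

  Generic : Pred WeightMatrix 0ℓ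
  Generic C = ∀ i j → i ≢ j → P i j → ∃! _≡_ (λ (π : P i j) → Critical C π)

  CriticalEdge : WeightMatrix → Subset #V → Rel V 0ℓ
  CriticalEdge C L i j = i ≢ j × P i j ×
    ((π : P i j) → Critical C π → ∀ k → k ∈ₗ interiorNodes π → k ∉ₛ L)

  data Connecting (C : WeightMatrix) (L : Subset #V) (i j : V) : Set where
    form-a : CriticalEdge C L i j → Connecting C L i j
    form-b : ∀ p → p ∉ₛ L → p ≢ i → p ≢ j →
             CriticalEdge C L p i → CriticalEdge C L p j → Connecting C L i j
    form-c : ∀ ℓ → ℓ ∈ₛ L →
             CriticalEdge C L i ℓ → CriticalEdge C L j ℓ → Connecting C L i j
    form-d : ∀ p ℓ → p ∉ₛ L → ℓ ∈ₛ L → p ≢ i → p ≢ j →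
             CriticalEdge C L p i → CriticalEdge C L p ℓ → CriticalEdge C L j ℓ →
             Connecting C L i j
    form-e : ∀ p ℓ q → p ∉ₛ L → ℓ ∈ₛ L → q ∉ₛ L →
             p ≢ i → p ≢ j → q ≢ i → q ≢ j → p ≢ q →
             CriticalEdge C L p i → CriticalEdge C L p ℓ →
             CriticalEdge C L q ℓ → CriticalEdge C L q j → Connecting C L i j

  Connected : WeightMatrix → Subset #V → Rel V 0ℓ
  Connected C L i j = Connecting C L i j ⊎ Connecting C L j i

  Maxoid : Set₁
  Maxoid = Pred (CIStatement #V) 0ℓ

  M⋆ : WeightMatrix → Maxoid
  M⋆ C [ I ⫫ J ∣ L ] =
    Empty (I ∩ J) × Empty (I ∩ L) × Empty (J ∩ L) ×
    (∀ i j → i ∈ₛ I → j ∈ₛ J → ¬ Connected C L i j)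

  pathTerm : ∀ {i j} → P i j → Term
  pathTerm ε              = oneTerm
  pathTerm ((e , _) ◅ π) = variableTerm e ⊗ pathTerm π

  pathPolynomial : V → V → Polynomial
  pathPolynomial i j = map pathTerm (paths i j)

  maxoidPolytope : Pred Space 0ℓ
  maxoidPolytope =
    minkowskiSum (map (λ (i , j) → Newt (pathPolynomial i j)) connectedPairs)

  N : Pred Space 0ℓ → Pred WeightMatrix 0ℓ
  N = normalCone maxoidPolytope

  -- Each of the following setoids compares elements by their first component:
  -- vertices as points, faces and maxoids as sets.
  Vertices : Setoid 0ℓ 0ℓ
  Vertices = On.setoid (≋-setoid #E)
    (proj₁ {B = IsVertex maxoidPolytope})

  Faces≥1 : Setoid (lsuc 0ℓ) 0ℓ
  Faces≥1 = On.setoid (≐-setoid Space 0ℓ)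
    (proj₁ {B = λ F → IsNonemptyFace maxoidPolytope F × DimAtLeast 1 F})

  GenericMaxoids : Setoid (lsuc 0ℓ) 0ℓ
  GenericMaxoids = On.setoid (≐-setoid (CIStatement #V) 0ℓ)
    (proj₁ {B = λ M → ∃ λ C → Generic C × M ≐ M⋆ C})

  NonGenericMaxoids : Setoid (lsuc 0ℓ) 0ℓ
  NonGenericMaxoids = On.setoid (≐-setoid (CIStatement #V) 0ℓ)
    (proj₁ {B = λ M → ∃ λ C → ¬ Generic C × M ≐ M⋆ C})

{-# OPTIONS --safe #-}

-- A face of P_G is the set of maximisers of some weight matrix C. Its points
-- are averages of sums of exponent vectors of C-critical paths, so D lies in its
-- normal cone iff every C-critical path is D-critical. Extrapolating from C
-- beyond D, and the openness of strict inequalities between path weights, show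
-- that D lies in the relative interior iff C and D have the same critical paths;
-- in particular the maxoid is constant there, and the face is a point iff C is
-- generic.
--
-- A generic maxoid determines its critical paths: if the unique critical paths
-- for C and D between the same nodes part at i towards ℓ and k, where k is not an
-- ancestor of ℓ, then i and their common endpoint are C*-separated but
-- D*-connected given the set of all ancestors of ℓ, with ℓ and without i.
module Submission where

open import Defs
open import Data.Product using (Σ; ∃; _×_; _,_; proj₁; proj₂)
open import Function.Bundles using (Bijection; Surjection)
open import Relation.Binary.Bundles using (Setoid)
open import Relation.Nullary using (¬_)
open import Relation.Unary using (_∈_; _≐_; Satisfiable)

import Algebra.Properties.CommutativeSemigroup as CommutativeSemigroupProperties
import Algebra.Properties.Monoid.Mult as MonoidMult
import Algebra.Properties.Ring as RingProperties
import Algebra.Properties.Semiring.Sum as SemiringSum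
open import Data.Bool.Base using (if_then_else_)
import Data.Fin.Base as Fin
open import Data.Fin.Base using (Fin; zero; suc)
import Data.Fin.Properties as Fin
open import Data.Fin.Subset using (Subset; ⁅_⁆) renaming (_∈_ to _∈ₛ_; _∉_ to _∉ₛ_)
open import Data.Fin.Subset.Properties using (x∈p∩q⁻; x∈⁅y⁆⇒x≡y; x∈⁅x⁆)
open import Data.List.Base using (List; []; _∷_; concatMap; map; allFin; length; cartesianProduct)
import Data.List.Extrema as Extrema
open import Data.List.Membership.Propositional using (lose) renaming (_∈_ to _∈ₗ_)
open import Data.List.Membership.Propositional.Properties
  using (∈-++⁺ˡ; ∈-++⁺ʳ; ∈-concatMap⁺; ∈-map⁺; ∈-allFin; ∈-filter⁺; ∈-cartesianProduct⁺)
open import Data.List.Relation.Unary.All as All using (All; []; _∷_; _[_]≔_)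
open import Data.List.Relation.Unary.All.Properties using (all-filter)
open import Data.List.Relation.Unary.Any as Any using (here; there)
open import Data.Nat.Base as ℕ using (ℕ; zero; suc)
import Data.Nat.Properties as ℕₚ
open import Data.Sum.Base as Sum using (_⊎_; inj₁; inj₂)
open import Data.Unit.Base using (⊤)
import Data.Vec.Base as Vec
open import Data.Vec.Functional using (Vector) renaming (_∷_ to _∷ᵛ_; [] to []ᵛ)
import Data.Vec.Properties as Vecₚ
open import Function.Base using (_∘_; case_of_)
open import Level using (0ℓ)
open import Relation.Binary.Bundles using (TotalOrder)
open import Relation.Binary.Construct.Closure.ReflexiveTransitive using (ε; _◅_; _◅◅_)
open import Relation.Binary.Construct.Closure.Transitive using (TransClosure; [_]) renaming (_∷_ to _∷⁺_)
open import Relation.Binary.PropositionalEquality as ≡ using (_≡_; _≢_)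
import Relation.Binary.Reasoning.PartialOrder as PartialOrderReasoning
open import Relation.Binary.Structures using (IsDecTotalOrder)
open import Relation.Nullary using (Dec; yes; no; does; contradiction; ¬?; _×-dec_)
open import Relation.Nullary.Decidable using (map′; dec-true; dec-false; decidable-stable)
open import Relation.Unary using (Pred)
open import Relation.Unary.Properties using (≐-refl; ≐-sym; ≐-trans)

-- The description of the points of a face is used only through pairings. A point `x` on the face of
-- `C` satisfies `total d χ ≤ ⟨ d , x ⟩` for every functional `d`, provided that the paths chosen by
-- `χ` are C-critical and no C-critical path is `d`-lighter than the chosen one. Taking `d = D` puts
-- `x` on the face of `D`; taking `d` to be plus and minus a coordinate shows that the face of a
-- generic matrix is one point. The Minkowski sum mixes all pairs of nodes. A single pair is
-- recovered by exchanging one path of a choice and keeping all others. Non-genericity is a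
-- negation, whereas a face of positive dimension has to exhibit two points. The paths of a finite
-- DAG can be listed, so a tie of two critical paths is decidable and the negation yields one as
-- data. The non-ancestor `k` always exists up to swapping the two matrices, because distinct nodes
-- of a DAG cannot be ancestors of each other.

-- Ordered field arithmetic, averages and extrapolation.

module OrderedField (ℝ : RealField) where
  open RealField ℝ hiding (zero)
  open IsDecTotalOrder isDecTotalOrder public
    using (_≤?_)
    renaming (refl to ≤-refl; trans to ≤-trans; antisym to ≤-antisym; total to ≤-total;
              reflexive to ≤-reflexive; _≟_ to _≈?_)
  open RingProperties ring
    using (//-rightDividesʳ; -‿distribˡ-*; -‿distribʳ-*; -‿involutive; -‿injective; -0#≈0#; xyx⁻¹≈y; x[y-z]≈xy-xz)
  open SemiringSum semiring
    using (sum; *-distribʳ-sum)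

  totalOrder : TotalOrder 0ℓ 0ℓ 0ℓ
  totalOrder = record { isTotalOrder = IsDecTotalOrder.isTotalOrder isDecTotalOrder }

  module ≤-Reasoning = PartialOrderReasoning (TotalOrder.poset totalOrder)
  open ≤-Reasoning

  <⇒≱ : ∀ {x y} → x < y → ¬ (y ≤ x)
  <⇒≱ (x≤y , x≉y) y≤x = x≉y (≤-antisym x≤y y≤x)

  ≰⇒> : ∀ {x y} → ¬ (x ≤ y) → y < x
  ≰⇒> {x} {y} x≰y with ≤-total x y
  ... | inj₁ x≤y = contradiction x≤y x≰y
  ... | inj₂ y≤x = y≤x , λ y≈x → x≰y (≤-reflexive (sym y≈x))

  <-≤-trans : ∀ {x y z} → x < y → y ≤ z → x < z
  <-≤-trans x<y y≤z = begin-strict _ <⟨ x<y ⟩ _ ≤⟨ y≤z ⟩ _ ∎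

  ≤-<-trans : ∀ {x y z} → x ≤ y → y < z → x < z
  ≤-<-trans x≤y y<z = begin-strict _ ≤⟨ x≤y ⟩ _ <⟨ y<z ⟩ _ ∎

  <-trans : ∀ {x y z} → x < y → y < z → x < z
  <-trans x<y y<z = <-≤-trans x<y (proj₁ y<z)

  +-mono-≤ : ∀ {x y u v} → x ≤ y → u ≤ v → x + u ≤ y + v
  +-mono-≤ {x} {y} {u} {v} x≤y u≤v = begin
    x + u  ≤⟨ +-monoˡ-≤ u x≤y ⟩
    y + u  ≈⟨ +-comm y u ⟩
    u + y  ≤⟨ +-monoˡ-≤ y u≤v ⟩
    v + y  ≈⟨ +-comm v y ⟩
    y + v  ∎

  +-cancelʳ-≤ : ∀ z {x y} → x + z ≤ y + z → x ≤ y
  +-cancelʳ-≤ z {x} {y} le = begin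
    x            ≈⟨ //-rightDividesʳ z x ⟨
    x + z + - z  ≤⟨ +-monoˡ-≤ (- z) le ⟩
    y + z + - z  ≈⟨ //-rightDividesʳ z y ⟩
    y            ∎

  +-cancelˡ-≤ : ∀ z {x y} → z + x ≤ z + y → x ≤ y
  +-cancelˡ-≤ z {x} {y} le = +-cancelʳ-≤ z (begin
    x + z  ≈⟨ +-comm x z ⟩
    z + x  ≤⟨ le ⟩
    z + y  ≈⟨ +-comm z y ⟩
    y + z  ∎)

  +-cancelʳ-< : ∀ z {x y} → x + z < y + z → x < y
  +-cancelʳ-< z (le , ≉) = +-cancelʳ-≤ z le , λ x≈y → ≉ (+-congʳ x≈y)

  +-mono-<-≤ : ∀ {x y u v} → x < y → u ≤ v → x + u < y + v
  +-mono-<-≤ {x} {y} {u} {v} x<y u≤v =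
    +-mono-≤ (proj₁ x<y) u≤v , λ eq → <⇒≱ x<y (+-cancelʳ-≤ u (begin
      y + u  ≤⟨ +-mono-≤ ≤-refl u≤v ⟩
      y + v  ≈⟨ eq ⟨
      x + u  ∎))

  +-mono-< : ∀ {x y u v} → x < y → u < v → x + u < y + v
  +-mono-< x<y u<v = +-mono-<-≤ x<y (proj₁ u<v)

  -- The equality case of adding two inequalities. It passes from the maximality of a Minkowski sum
  -- or of an average to the maximality of each summand.
  +-tightˡ : ∀ {x y u v} → x ≤ y → u ≤ v → y + v ≤ x + u → y ≤ x
  +-tightˡ {x} {y} {u} {v} x≤y u≤v le =
    +-cancelʳ-≤ v (≤-trans le (+-mono-≤ ≤-refl u≤v))

  +-tightʳ : ∀ {x y u v} → x ≤ y → u ≤ v → y + v ≤ x + u → v ≤ u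
  +-tightʳ {x} {y} {u} {v} x≤y u≤v le =
    +-cancelˡ-≤ y (≤-trans le (+-monoˡ-≤ u x≤y))

  neg-mono-≤ : ∀ {x y} → x ≤ y → - y ≤ - x
  neg-mono-≤ {x} {y} x≤y = +-cancelʳ-≤ y (begin
    - y + y  ≈⟨ -‿inverseˡ y ⟩
    0#       ≈⟨ -‿inverseˡ x ⟨
    - x + x  ≤⟨ +-mono-≤ ≤-refl x≤y ⟩
    - x + y  ∎)

  neg-mono-< : ∀ {x y} → x < y → - y < - x
  neg-mono-< (x≤y , x≉y) = neg-mono-≤ x≤y , λ eq → x≉y (sym (-‿injective eq))

  neg-cancel-≤ : ∀ {x y} → - y ≤ - x → x ≤ y
  neg-cancel-≤ {x} {y} le = begin
    x      ≈⟨ -‿involutive x ⟨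
    - - x  ≤⟨ neg-mono-≤ le ⟩
    - - y  ≈⟨ -‿involutive y ⟩
    y      ∎

  *-monoˡ-≤ : ∀ {a x y} → 0# ≤ a → x ≤ y → a * x ≤ a * y
  *-monoˡ-≤ {a} {x} {y} 0≤a x≤y = +-cancelʳ-≤ (- (a * x)) (begin
    a * x - a * x  ≈⟨ -‿inverseʳ (a * x) ⟩
    0#             ≤⟨ *-nonNegative 0≤a 0≤y-x ⟩
    a * (y - x)    ≈⟨ x[y-z]≈xy-xz a y x ⟩
    a * y - a * x  ∎)
    where
    0≤y-x : 0# ≤ y - x
    0≤y-x = begin
      0#     ≈⟨ -‿inverseʳ x ⟨
      x - x  ≤⟨ +-monoˡ-≤ (- x) x≤y ⟩
      y - x  ∎

  *-cancelˡ-≈ : ∀ {a x y} → ¬ (a ≈ 0#) → a * x ≈ a * y → x ≈ y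
  *-cancelˡ-≈ {a} {x} {y} a≉0 eq with inverse a a≉0
  ... | b , ab≈1 = trans (sym (undo x)) (trans (*-congˡ eq) (undo y))
    where
    undo : ∀ z → b * (a * z) ≈ z
    undo z = trans (sym (*-assoc b a z))
                   (trans (*-congʳ (trans (*-comm b a) ab≈1)) (*-identityˡ z))

  *-monoˡ-< : ∀ {a x y} → 0# < a → x < y → a * x < a * y
  *-monoˡ-< (0≤a , 0≉a) (x≤y , x≉y) =
    *-monoˡ-≤ 0≤a x≤y , λ eq → x≉y (*-cancelˡ-≈ (λ a≈0 → 0≉a (sym a≈0)) eq)

  *-cancelˡ-≤ : ∀ {a x y} → 0# < a → a * x ≤ a * y → x ≤ y
  *-cancelˡ-≤ {a} {x} {y} 0<a le with x ≤? y
  ... | yes x≤y = x≤y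
  ... | no  x≰y = contradiction le (<⇒≱ (*-monoˡ-< 0<a (≰⇒> x≰y)))

  *-pos : ∀ {x y} → 0# < x → 0# < y → 0# < x * y
  *-pos {x} {y} 0<x 0<y = begin-strict
    0#      ≈⟨ zeroʳ x ⟨
    x * 0#  <⟨ *-monoˡ-< 0<x 0<y ⟩
    x * y   ∎

  0<1 : 0# < 1#
  0<1 = 0≤1 , λ 0≈1 → 1≉0 (sym 0≈1)
    where
    0≤1 : 0# ≤ 1#
    0≤1 with ≤-total 0# 1#
    ... | inj₁ 0≤1 = 0≤1
    ... | inj₂ 1≤0 = begin
      0#           ≤⟨ *-nonNegative 0≤-1 0≤-1 ⟩
      - 1# * - 1#  ≈⟨ -‿distribˡ-* 1# (- 1#) ⟨
      - (1# * - 1#) ≈⟨ -‿cong (*-identityˡ (- 1#)) ⟩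
      - - 1#       ≈⟨ -‿involutive 1# ⟩
      1#           ∎
      where
      0≤-1 : 0# ≤ - 1#
      0≤-1 = +-cancelʳ-≤ 1# (begin
        0# + 1#    ≈⟨ +-identityˡ 1# ⟩
        1#         ≤⟨ 1≤0 ⟩
        0#         ≈⟨ -‿inverseˡ 1# ⟨
        - 1# + 1#  ∎)

  +-pos : ∀ {x y} → 0# < x → 0# < y → 0# < x + y
  +-pos {x} {y} 0<x 0<y = begin-strict
    0#       ≈⟨ +-identityˡ 0# ⟨
    0# + 0#  <⟨ +-mono-< 0<x 0<y ⟩
    x + y    ∎

  x<x+y : ∀ {x y} → 0# < y → x < x + y
  x<x+y {x} {y} 0<y = begin-strict
    x       ≈⟨ +-identityˡ x ⟨
    0# + x  <⟨ +-mono-<-≤ 0<y ≤-refl ⟩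
    y + x   ≈⟨ +-comm y x ⟩
    x + y   ∎

  y<x+y : ∀ {x y} → 0# < x → y < x + y
  y<x+y {x} {y} 0<x = <-≤-trans (x<x+y 0<x) (≤-reflexive (+-comm y x))

  positiveInverse : ∀ {x} → 0# < x → ∃ λ y → 0# < y × x * y ≈ 1#
  positiveInverse {x} 0<x@(_ , 0≉x) with inverse x (λ x≈0 → 0≉x (sym x≈0))
  ... | y , xy≈1 = y , ≰⇒> (λ y≤0 → <⇒≱ 0<1 (begin
    1#      ≈⟨ xy≈1 ⟨
    x * y   ≤⟨ *-monoˡ-≤ (proj₁ 0<x) y≤0 ⟩
    x * 0#  ≈⟨ zeroʳ x ⟩
    0#      ∎)) , xy≈1

  halve : ∀ {x} → 0# < x → ∃ λ y → 0# < y × y + y ≈ x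
  halve {x} 0<x with positiveInverse (+-pos 0<1 0<1)
  ... | h , 0<h , 2h≈1 = h * x , *-pos 0<h 0<x , (begin-equality
    h * x + h * x      ≈⟨ distribʳ x h h ⟨
    (h + h) * x        ≈⟨ *-congʳ (+-cong (*-identityˡ h) (*-identityˡ h)) ⟨
    (1# * h + 1# * h) * x ≈⟨ *-congʳ (distribʳ h 1# 1#) ⟨
    (1# + 1#) * h * x  ≈⟨ *-congʳ 2h≈1 ⟩
    1# * x             ≈⟨ *-identityˡ x ⟩
    x                  ∎)

  lowerBound₂ : ∀ {x y} → 0# < x → 0# < y → ∃ λ z → 0# < z × z ≤ x × z ≤ y
  lowerBound₂ {x} {y} 0<x 0<y with ≤-total x y
  ... | inj₁ x≤y = x , 0<x , ≤-refl , x≤y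
  ... | inj₂ y≤x = y , 0<y , y≤x , ≤-refl

  sum-mono : ∀ {n} {u v : Vector Carrier n} → (∀ s → u s ≤ v s) → sum u ≤ sum v
  sum-mono {zero}  u≤v = ≤-refl
  sum-mono {suc n} u≤v = +-mono-≤ (u≤v zero) (sum-mono (λ s → u≤v (suc s)))

  sum-tight : ∀ {n} {u v : Vector Carrier n} → (∀ s → u s ≤ v s) → sum v ≤ sum u →
              ∀ s → v s ≤ u s
  sum-tight {suc n} u≤v le zero    =
    +-tightˡ (u≤v zero) (sum-mono (λ s → u≤v (suc s))) le
  sum-tight {suc n} u≤v le (suc s) =
    sum-tight (λ s → u≤v (suc s)) (+-tightʳ (u≤v zero) (sum-mono (λ s → u≤v (suc s))) le) s

  module Average {n} (a : Vector Carrier n) (0≤a : ∀ s → 0# ≤ a s) (Σa≈1 : sum a ≈ 1#) where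

    average-const : ∀ B → sum (λ s → a s * B) ≈ B
    average-const B = begin-equality
      sum (λ s → a s * B)  ≈⟨ *-distribʳ-sum B a ⟨
      sum a * B            ≈⟨ *-congʳ Σa≈1 ⟩
      1# * B               ≈⟨ *-identityˡ B ⟩
      B                    ∎

    average-≤ : ∀ {B} {x : Vector Carrier n} → (∀ s → x s ≤ B) → sum (λ s → a s * x s) ≤ B
    average-≤ {B} {x} x≤B = begin
      sum (λ s → a s * x s)  ≤⟨ sum-mono (λ s → *-monoˡ-≤ (0≤a s) (x≤B s)) ⟩
      sum (λ s → a s * B)    ≈⟨ average-const B ⟩
      B                      ∎

    -- An average that attains the upper bound B only charges entries equal to B.
    average-≥ : ∀ {B D} {x y : Vector Carrier n} →
                (∀ s → x s ≤ B) → B ≤ sum (λ s → a s * x s) →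
                (∀ s → B ≤ x s → D ≤ y s) → D ≤ sum (λ s → a s * y s)
    average-≥ {B} {D} {x} {y} x≤B B≤Σax attained = begin
      D                      ≈⟨ average-const D ⟨
      sum (λ s → a s * D)    ≤⟨ sum-mono aD≤ay ⟩
      sum (λ s → a s * y s)  ∎
      where
      aB≤ax : ∀ s → a s * B ≤ a s * x s
      aB≤ax = sum-tight (λ s → *-monoˡ-≤ (0≤a s) (x≤B s))
                        (≤-trans (≤-reflexive (average-const B)) B≤Σax)

      aD≤ay : ∀ s → a s * D ≤ a s * y s
      aD≤ay s with 0# ≈? a s
      ... | yes 0≈a = begin
        a s * D    ≈⟨ *-congʳ 0≈a ⟨
        0# * D     ≈⟨ trans (zeroˡ D) (sym (zeroˡ (y s))) ⟩
        0# * y s   ≈⟨ *-congʳ 0≈a ⟩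
        a s * y s  ∎
      ... | no 0≉a =
        *-monoˡ-≤ (0≤a s) (attained s (*-cancelˡ-≤ (0≤a s , 0≉a) (aB≤ax s)))

  -- The value at X + η (X - x), written as the affine combination 1 X + η X - η x.
  extrapolate : Carrier → Carrier → Carrier → Carrier
  extrapolate η X x = 1# * X + (η * X + (- η * x + 0#))

  extrapolate-offset : ∀ η X x → extrapolate η X x - X ≈ η * (X - x)
  extrapolate-offset η X x = begin-equality
    1# * X + (η * X + (- η * x + 0#)) - X  ≈⟨ +-congʳ (+-congʳ (*-identityˡ X)) ⟩
    X + (η * X + (- η * x + 0#)) - X       ≈⟨ xyx⁻¹≈y X _ ⟩
    η * X + (- η * x + 0#)                 ≈⟨ +-congˡ (+-identityʳ _) ⟩
    η * X + - η * x                        ≈⟨ +-congˡ (-‿distribˡ-* η x) ⟨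
    η * X - η * x                          ≈⟨ x[y-z]≈xy-xz η X x ⟨
    η * (X - x)                            ∎

  extrapolate-reflects : ∀ {η X Y x y} → 0# < η → X ≈ Y →
                         extrapolate η X x ≤ extrapolate η Y y → y ≤ x
  extrapolate-reflects {η} {X} {Y} {x} {y} 0<η X≈Y le =
    *-cancelˡ-≤ 0<η (neg-cancel-≤ (begin
      - (η * x)     ≈⟨ -‿distribˡ-* η x ⟩
      - η * x       ≤⟨ +-cancelʳ-≤ 0# (+-cancelˡ-≤ (η * X) (+-cancelˡ-≤ (1# * X) le′)) ⟩
      - η * y       ≈⟨ -‿distribˡ-* η y ⟨
      - (η * y)     ∎))
    where
    le′ : extrapolate η X x ≤ extrapolate η X y
    le′ = begin
      extrapolate η X x  ≤⟨ le ⟩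
      extrapolate η Y y  ≈⟨ +-cong (*-congˡ X≈Y) (+-congʳ (*-congˡ X≈Y)) ⟨
      extrapolate η X y  ∎

  -- Bounds are added up instead of maximised: each entry contributes its absolute value plus one,
  -- which keeps every inequality strict.
  absolutelyBounded : ∀ {n} (x : Vector Carrier n) →
                      ∃ λ M → 0# < M × (∀ s → x s < M × - x s < M)
  absolutelyBounded {zero}  x = 1# , 0<1 , λ ()
  absolutelyBounded {suc n} x
    with absolutelyBounded (λ s → x (suc s)) | ≤-total 0# (x zero)
  ... | M , 0<M , x<M | inj₁ 0≤x₀ =
    x zero + 1# + M , +-pos 0<N 0<M , λ where
      zero    → <-trans (x<x+y 0<1) (x<x+y 0<M) , ≤-<-trans -x₀≤0 (+-pos 0<N 0<M)
      (suc s) → <-trans (proj₁ (x<M s)) (y<x+y 0<N) , <-trans (proj₂ (x<M s)) (y<x+y 0<N)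
    where
    0<N : 0# < x zero + 1#
    0<N = ≤-<-trans 0≤x₀ (x<x+y 0<1)

    -x₀≤0 : - x zero ≤ 0#
    -x₀≤0 = ≤-trans (neg-mono-≤ 0≤x₀) (≤-reflexive -0#≈0#)
  ... | M , 0<M , x<M | inj₂ x₀≤0 =
    - x zero + 1# + M , +-pos 0<N 0<M , λ where
      zero    → ≤-<-trans x₀≤0 (+-pos 0<N 0<M) , <-trans (x<x+y 0<1) (x<x+y 0<M)
      (suc s) → <-trans (proj₁ (x<M s)) (y<x+y 0<N) , <-trans (proj₂ (x<M s)) (y<x+y 0<N)
    where
    0<N : 0# < - x zero + 1#
    0<N = ≤-<-trans (≤-trans (≤-reflexive (sym -0#≈0#)) (neg-mono-≤ x₀≤0)) (x<x+y 0<1)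

  contraction : ∀ {n r} (x : Vector Carrier n) → 0# < r →
                ∃ λ η → 0# < η × (∀ s → (- r < η * x s) × (η * x s < r))
  contraction {r = r} x 0<r with absolutelyBounded x
  ... | M , 0<M , x<M with positiveInverse 0<M
  -- The factor is `r / M`, where `M` strictly bounds all entries and their negatives.
  ... | m , 0<m , Mm≈1 = r * m , *-pos 0<r 0<m , λ s → lower s , scale (proj₁ (x<M s))
    where
    scale : ∀ {y} → y < M → r * m * y < r
    scale {y} y<M = begin-strict
      r * m * y    <⟨ *-monoˡ-< (*-pos 0<r 0<m) y<M ⟩
      r * m * M    ≈⟨ *-assoc r m M ⟩
      r * (m * M)  ≈⟨ *-congˡ (trans (*-comm m M) Mm≈1) ⟩
      r * 1#       ≈⟨ *-identityʳ r ⟩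
      r            ∎

    lower : ∀ s → - r < r * m * x s
    lower s = begin-strict
      - r                    <⟨ neg-mono-< (scale (proj₂ (x<M s))) ⟩
      - (r * m * - x s)      ≈⟨ -‿cong (-‿distribʳ-* (r * m) (x s)) ⟨
      - - (r * m * x s)      ≈⟨ -‿involutive _ ⟩
      r * m * x s            ∎

-- Pairings, interiors, affine lines and affine independence.

module ConvexGeometry (ℝ : RealField) (d : ℕ) where
  open RealField ℝ hiding (zero)
  open OrderedField ℝ
  open Convexity ℝ d
  open SemiringSum semiring
    using (sum; sum-cong-≋; sum-replicate-zero; ∑-distrib-+; ∑-comm; *-distribˡ-sum)
  open RingProperties ring
    using (-‿distribˡ-*; -0#≈0#; +-inverseʳ-unique; x∙y⁻¹≈ε⇒x≈y)
  open ≤-Reasoning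

  ⟨⟩-congʳ : ∀ c {x y} → x ≋ y → ⟨ c , x ⟩ ≈ ⟨ c , y ⟩
  ⟨⟩-congʳ c x≋y = sum-cong-≋ (λ e → *-congˡ (x≋y e))

  ⟨⟩-zeroʳ : ∀ c → ⟨ c , (λ _ → 0#) ⟩ ≈ 0#
  ⟨⟩-zeroʳ c = trans (sum-cong-≋ (λ e → zeroʳ (c e))) (sum-replicate-zero d)

  ⟨⟩-+ʳ : ∀ c x y → ⟨ c , (λ e → x e + y e) ⟩ ≈ ⟨ c , x ⟩ + ⟨ c , y ⟩
  ⟨⟩-+ʳ c x y = trans (sum-cong-≋ (λ e → distribˡ (c e) (x e) (y e)))
                      (∑-distrib-+ (λ e → c e * x e) (λ e → c e * y e))

  ⟨⟩-linearCombination : ∀ c {k} (a : Vector Carrier k) p →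
                         ⟨ c , linearCombination a p ⟩ ≈ sum (λ s → a s * ⟨ c , p s ⟩)
  ⟨⟩-linearCombination c a p = begin-equality
    sum (λ e → c e * sum (λ s → a s * p s e))
      ≈⟨ sum-cong-≋ (λ e → *-distribˡ-sum (c e) (λ s → a s * p s e)) ⟩
    sum (λ e → sum (λ s → c e * (a s * p s e)))
      ≈⟨ ∑-comm (λ e s → c e * (a s * p s e)) ⟩
    sum (λ s → sum (λ e → c e * (a s * p s e)))
      ≈⟨ sum-cong-≋ (λ s → sum-cong-≋ (λ e → swap (c e) (a s) (p s e))) ⟩
    sum (λ s → sum (λ e → a s * (c e * p s e)))
      ≈⟨ sum-cong-≋ (λ s → *-distribˡ-sum (a s) (λ e → c e * p s e)) ⟨
    sum (λ s → a s * ⟨ c , p s ⟩)  ∎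
    where
    swap : ∀ x y z → x * (y * z) ≈ y * (x * z)
    swap x y z = trans (sym (*-assoc x y z)) (trans (*-congʳ (*-comm x y)) (*-assoc y x z))

  maximal : ∀ {c Q x} → x ∈ Q → (∀ y → y ∈ Q → ⟨ c , y ⟩ ≤ ⟨ c , x ⟩) → IsMax c Q ⟨ c , x ⟩
  maximal x∈Q bound = (_ , x∈Q , refl) , bound

  face : Space → Pred Space 0ℓ → Pred Space 0ℓ
  face c Q x = x ∈ Q × IsMax c Q ⟨ c , x ⟩

  ball-mono : ∀ {c r s} → r ≤ s → ∀ {x} → x ∈ Ball c r → x ∈ Ball c s
  ball-mono r≤s x∈B e =
    ≤-<-trans (neg-mono-≤ r≤s) (proj₁ (x∈B e)) , <-≤-trans (proj₂ (x∈B e)) r≤s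

  center∈ball : ∀ {c r} → 0# < r → c ∈ Ball c r
  center∈ball {c} {r} 0<r e =
      (begin-strict
        - r      <⟨ neg-mono-< 0<r ⟩
        - 0#     ≈⟨ -0#≈0# ⟩
        0#       ≈⟨ -‿inverseʳ (c e) ⟨
        c e - c e ∎)
    , (begin-strict
        c e - c e ≈⟨ -‿inverseʳ (c e) ⟩
        0#       <⟨ 0<r ⟩
        r        ∎)

  interior⊆relativeInterior : ∀ {S c} → c ∈ interior S → c ∈ relativeInterior S
  interior⊆relativeInterior (r , 0<r , ball⊆S) =
    ball⊆S _ (center∈ball 0<r) , r , 0<r , λ x _ → ball⊆S x

  interior-universal : ∀ {S : Pred Space 0ℓ} {c} → (∀ x → x ∈ S) → c ∈ interior S
  interior-universal all = 1# , 0<1 , λ x _ → all x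

  interior-mono : ∀ {S T c} → (∀ x → x ∈ S → x ∈ T) → c ∈ interior S → c ∈ interior T
  interior-mono S⊆T (r , 0<r , ball⊆S) = r , 0<r , λ x x∈B → S⊆T x (ball⊆S x x∈B)

  interior-∩ : ∀ {S T c} → c ∈ interior S → c ∈ interior T →
               c ∈ interior (λ x → x ∈ S × x ∈ T)
  interior-∩ (r , 0<r , ball⊆S) (s , 0<s , ball⊆T) with lowerBound₂ 0<r 0<s
  ... | t , 0<t , t≤r , t≤s = t , 0<t , λ x x∈B →
    ball⊆S x (ball-mono t≤r x∈B) , ball⊆T x (ball-mono t≤s x∈B)

  -- Finitely many balls around `c` contain a common one. The list form allows a single radius for
  -- all pairs of paths.
  interior-∀ : ∀ {A : Set} {S : A → Pred Space 0ℓ} {c} xs → (∀ z → c ∈ interior (S z)) →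
               c ∈ interior (λ x → ∀ z → z ∈ₗ xs → x ∈ S z)
  interior-∀         []       near = interior-universal (λ _ _ ())
  interior-∀ {S = S} (z ∷ zs) near =
    interior-mono (λ _ (p , q) → λ where
        z′ (here ≡.refl) → p
        z′ (there z′∈)   → q z′ z′∈)
      (interior-∩ (near z) (interior-∀ {S = S} zs near))

  -- This is `C + η (C - c)`, a point beyond `C` on the line from `c`. Listing `C` twice gives
  -- coefficients whose sum is 1 by cancelling `η`, and makes each coordinate unfold to
  -- `extrapolate`.
  affineLine : Carrier → Space → Space → Space
  affineLine η C c = linearCombination (1# ∷ᵛ η ∷ᵛ - η ∷ᵛ []ᵛ) (C ∷ᵛ C ∷ᵛ c ∷ᵛ []ᵛ)

  affineLine∈aff : ∀ η {S C c} → C ∈ S → c ∈ S → affineLine η C c ∈ aff S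
  affineLine∈aff η {C = C} {c} C∈S c∈S =
    3 , (1# ∷ᵛ η ∷ᵛ - η ∷ᵛ []ᵛ) , (C ∷ᵛ C ∷ᵛ c ∷ᵛ []ᵛ)
    , (λ where
         zero             → C∈S
         (suc zero)       → C∈S
         (suc (suc zero)) → c∈S)
    , sum≈1
    , λ _ → refl
    where
    sum≈1 : 1# + (η + (- η + 0#)) ≈ 1#
    sum≈1 = begin-equality
      1# + (η + (- η + 0#))  ≈⟨ +-congˡ (+-congˡ (+-identityʳ (- η))) ⟩
      1# + (η - η)           ≈⟨ +-congˡ (-‿inverseʳ η) ⟩
      1# + 0#                ≈⟨ +-identityʳ 1# ⟩
      1#                     ∎

  affineLine∈ball : ∀ C c {r} → 0# < r → ∃ λ η → 0# < η × affineLine η C c ∈ Ball C r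
  affineLine∈ball C c {r} 0<r with contraction (λ e → C e - c e) 0<r
  ... | η , 0<η , small = η , 0<η , λ e →
      (begin-strict
        - r                              <⟨ proj₁ (small e) ⟩
        η * (C e - c e)                  ≈⟨ extrapolate-offset η (C e) (c e) ⟨
        extrapolate η (C e) (c e) - C e  ∎)
    , (begin-strict
        extrapolate η (C e) (c e) - C e  ≈⟨ extrapolate-offset η (C e) (c e) ⟩
        η * (C e - c e)                  <⟨ proj₂ (small e) ⟩
        r                                ∎)

  affinelyIndependent⇒distinct : ∀ (p : Vector Space 2) → AffinelyIndependent p →
                                 ¬ (p zero ≋ p (suc zero))
  affinelyIndependent⇒distinct p indep p₀≋p₁ =
    1≉0 (indep (1# ∷ᵛ - 1# ∷ᵛ []ᵛ) sum≈0 combination≋0 zero)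
    where
    sum≈0 : 1# + (- 1# + 0#) ≈ 0#
    sum≈0 = trans (+-congˡ (+-identityʳ (- 1#))) (-‿inverseʳ 1#)

    combination≋0 : linearCombination (1# ∷ᵛ - 1# ∷ᵛ []ᵛ) p ≋ (λ _ → 0#)
    combination≋0 e = begin-equality
      1# * p zero e + (- 1# * p (suc zero) e + 0#)
        ≈⟨ +-cong (*-congˡ (p₀≋p₁ e)) (+-identityʳ _) ⟩
      1# * p (suc zero) e + - 1# * p (suc zero) e
        ≈⟨ distribʳ (p (suc zero) e) 1# (- 1#) ⟨
      (1# - 1#) * p (suc zero) e
        ≈⟨ *-congʳ (-‿inverseʳ 1#) ⟩
      0# * p (suc zero) e
        ≈⟨ zeroˡ _ ⟩
      0#  ∎

  -- The coefficients are `a₀` and `- a₀`, so coordinate `e` gives `a₀ * x e ≈ a₀ * y e`, and a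
  -- nonzero `a₀` could be cancelled.
  distinct⇒affinelyIndependent : ∀ {x y : Space} e → ¬ (x e ≈ y e) →
                                 AffinelyIndependent (x ∷ᵛ y ∷ᵛ []ᵛ)
  distinct⇒affinelyIndependent {x} {y} e x≉y a Σa≈0 Σap≋0 = a≈0
    where
    a₀ = a zero
    a₁ = a (suc zero)

    a₁≈-a₀ : a₁ ≈ - a₀
    a₁≈-a₀ = +-inverseʳ-unique a₀ a₁ (trans (+-congˡ (sym (+-identityʳ a₁))) Σa≈0)

    a₀x≈a₀y : a₀ * x e ≈ a₀ * y e
    a₀x≈a₀y = x∙y⁻¹≈ε⇒x≈y (a₀ * x e) (a₀ * y e) (begin-equality
      a₀ * x e - a₀ * y e           ≈⟨ +-congˡ (-‿distribˡ-* a₀ (y e)) ⟩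
      a₀ * x e + - a₀ * y e         ≈⟨ +-congˡ (*-congʳ a₁≈-a₀) ⟨
      a₀ * x e + a₁ * y e           ≈⟨ +-congˡ (+-identityʳ _) ⟨
      a₀ * x e + (a₁ * y e + 0#)    ≈⟨ Σap≋0 e ⟩
      0#                            ∎)

    a₀≈0 : a₀ ≈ 0#
    a₀≈0 with a₀ ≈? 0#
    ... | yes eq = eq
    ... | no  ne = contradiction (*-cancelˡ-≈ ne a₀x≈a₀y) x≉y

    a≈0 : ∀ s → a s ≈ 0#
    a≈0 zero       = a₀≈0
    a≈0 (suc zero) = begin-equality
      a₁    ≈⟨ a₁≈-a₀ ⟩
      - a₀  ≈⟨ -‿cong a₀≈0 ⟩
      - 0#  ≈⟨ -0#≈0# ⟩
      0#    ∎

-- Paths in a finite DAG: enumeration, reachability and divergence.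

module PathProperties (G : DAG) where
  open Paths G

  _◅⁺_ : ∀ {i j k} → i ⟶ j → P j k → TransClosure _⟶_ i k
  x ◅⁺ ε       = [ x ]
  x ◅⁺ (y ◅ π) = x ∷⁺ (y ◅⁺ π)

  no-return : ∀ {i j} → i ⟶ j → ¬ P j i
  no-return x π = acyclic _ (x ◅⁺ π)

  P-antisym : ∀ {i j} → P i j → P j i → i ≡ j
  P-antisym ε       ρ = ≡.refl
  P-antisym (x ◅ π) ρ = contradiction (π ◅◅ ρ) (no-return x)

  P-loop : ∀ {i} (π ρ : P i i) → π ≡ ρ
  P-loop ε       ε       = ≡.refl
  P-loop (x ◅ π) _       = contradiction π (no-return x)
  P-loop ε       (y ◅ ρ) = contradiction ρ (no-return y)

  size : ∀ {i j} → P i j → ℕ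
  size ε       = 0
  size (_ ◅ π) = suc (size π)

  nodeAt : ∀ {i j} (π : P i j) → Fin (suc (size π)) → V
  nodeAt {i} _       zero    = i
  nodeAt     (_ ◅ π) (suc a) = nodeAt π a

  prefix : ∀ {i j} (π : P i j) a → P i (nodeAt π a)
  prefix _       zero    = ε
  prefix (x ◅ π) (suc a) = x ◅ prefix π a

  nodeAt-mono : ∀ {i j} (π : P i j) {a b} → a Fin.< b → TransClosure _⟶_ (nodeAt π a) (nodeAt π b)
  nodeAt-mono (x ◅ π) {zero}  {suc b} _   = x ◅⁺ prefix π b
  nodeAt-mono (_ ◅ π) {suc a} {suc b} a<b = nodeAt-mono π (ℕ.s<s⁻¹ a<b)

  -- A path has one more position than edges. With too many edges two positions would carry the same
  -- node, and the stretch between them would be a cycle.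
  size<#V : ∀ {i j} (π : P i j) → size π ℕ.< #V
  size<#V π = ℕₚ.≰⇒> λ #V≤size →
    let a , b , a<b , eq = Fin.pigeonhole (ℕ.s≤s #V≤size) (nodeAt π)
    in acyclic _ (≡.subst (TransClosure _⟶_ _) (≡.sym eq) (nodeAt-mono π a<b))

  ε∈emptyPath : ∀ j → ε ∈ₗ emptyPath j j
  ε∈emptyPath j with j Fin.≟ j
  ... | yes ≡.refl = here ≡.refl
  ... | no  j≢j    = contradiction ≡.refl j≢j

  -- Names the local function of which longerPaths is a concatMap.
  pathsVia : ∀ k i j → E → List (P i j)
  pathsVia k i j = function (≡.refl {x = longerPaths k i j})
    where
    function : {f : E → List (P i j)} → concatMap f (allFin #E) ≡ longerPaths k i j → E → List (P i j)
    function {f} _ = f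

  ∈-pathsUpTo : ∀ {k i j} (π : P i j) → size π ℕ.≤ k → π ∈ₗ pathsUpTo k i j
  ∈-pathsVia : ∀ {k j} e (π : P (target e) j) → size π ℕ.≤ k →
               ((e , ≡.refl , ≡.refl) ◅ π) ∈ₗ pathsVia k (source e) j e

  ∈-pathsUpTo {zero}  ε _ = ε∈emptyPath _
  ∈-pathsUpTo {suc k} ε _ = ∈-++⁺ˡ (ε∈emptyPath _)
  ∈-pathsUpTo {suc k} {i} {j} ((e , ≡.refl , ≡.refl) ◅ π) (ℕ.s≤s size≤k) =
    ∈-++⁺ʳ (emptyPath i j)
      (∈-concatMap⁺ (pathsVia k i j) (lose (∈-allFin e) (∈-pathsVia e π size≤k)))

  ∈-pathsVia e π size≤k with source e Fin.≟ source e
  ... | yes ≡.refl = ∈-map⁺ _ (∈-pathsUpTo π size≤k)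
  ... | no  s≢s    = contradiction ≡.refl s≢s

  ∈-paths : ∀ {i j} (π : P i j) → π ∈ₗ paths i j
  ∈-paths π = ∈-pathsUpTo π (ℕₚ.<⇒≤ (size<#V π))

  reachable? : ∀ i j → Dec (P i j)
  -- Completeness is abstracted together with the list, so that it refutes the empty case.
  reachable? i j with paths i j | ∈-paths {i} {j}
  ... | []    | complete = no λ π → case complete π of λ ()
  ... | π ∷ _ | _        = yes π

  -- A positive form of `π ≢ ρ`. In a DAG neither of two paths with the same ends is a proper
  -- initial segment of the other, so distinct ones leave some common node by different edges.
  data Diverge {j} : ∀ {i} → P i j → P i j → Set where
    fork : ∀ {i k l} {x : i ⟶ k} {y : i ⟶ l} {π : P k j} {ρ : P l j} →
           proj₁ x ≢ proj₁ y → Diverge (x ◅ π) (y ◅ ρ)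
    step : ∀ {i k} {x : i ⟶ k} {π ρ : P k j} → Diverge π ρ → Diverge (x ◅ π) (x ◅ ρ)

  diverge-irrefl : ∀ {i j} {π : P i j} → ¬ Diverge π π
  diverge-irrefl (fork e≢e) = e≢e ≡.refl
  diverge-irrefl (step d)   = diverge-irrefl d

  diverge⇒≢ : ∀ {i j} {π ρ : P i j} → Diverge π ρ → i ≢ j
  diverge⇒≢ {π = π} {ρ} d ≡.refl with P-loop π ρ
  ... | ≡.refl = diverge-irrefl d

  compare : ∀ {i j} (π ρ : P i j) → π ≡ ρ ⊎ Diverge π ρ
  compare ε       ε       = inj₁ ≡.refl
  compare ε       (y ◅ ρ) = contradiction ρ (no-return y)
  compare (x ◅ π) ε       = contradiction π (no-return x)
  compare ((e , ≡.refl , ≡.refl) ◅ π) ((e′ , s , ≡.refl) ◅ ρ) with e Fin.≟ e′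
  ... | no  e≢e′   = inj₂ (fork e≢e′)
  ... | yes ≡.refl with s | compare π ρ
  ...   | ≡.refl | inj₁ ≡.refl = inj₁ ≡.refl
  ...   | ≡.refl | inj₂ d      = inj₂ (step d)

  interior-reachable : ∀ {i k j} (x : i ⟶ k) (π : P k j) {v} → v ∈ₗ interiorNodes (x ◅ π) → P k v
  interior-reachable x (y ◅ π) (here ≡.refl) = ε
  interior-reachable x (y ◅ π) (there v∈)    = y ◅ interior-reachable y π v∈

-- Critical paths and how the maxoid depends on them.

module CriticalPaths (ℝ : RealField) (G : DAG) where
  open RealField ℝ hiding (zero)
  open OrderedField ℝ
  open Paths G
  open PathProperties G
  open Maxoids ℝ G
  open ConvexGeometry ℝ #E
  open SemiringSum semiring
    using (sum; sum-cong-≋; sum-replicate-zero; ∑-distrib-+)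
  open ≤-Reasoning

  weight-linearCombination : ∀ {k} (a : Vector Carrier k) p {i j} (π : P i j) →
    weight (linearCombination a p) π ≈ sum (λ s → a s * weight (p s) π)
  weight-linearCombination {k} a p ε =
    sym (trans (sum-cong-≋ (λ s → zeroʳ (a s))) (sum-replicate-zero k))
  weight-linearCombination a p ((e , _) ◅ π) = begin-equality
    sum (λ s → a s * p s e) + weight (linearCombination a p) π
      ≈⟨ +-congˡ (weight-linearCombination a p π) ⟩
    sum (λ s → a s * p s e) + sum (λ s → a s * weight (p s) π)
      ≈⟨ ∑-distrib-+ (λ s → a s * p s e) (λ s → a s * weight (p s) π) ⟨
    sum (λ s → a s * p s e + a s * weight (p s) π)
      ≈⟨ sum-cong-≋ (λ s → distribˡ (a s) (p s e) (weight (p s) π)) ⟨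
    sum (λ s → a s * (p s e + weight (p s) π))  ∎

  weight-affineLine : ∀ η C c {i j} (π : P i j) →
    weight (affineLine η C c) π ≈ extrapolate η (weight C π) (weight c π)
  weight-affineLine η C c =
    weight-linearCombination (1# ∷ᵛ η ∷ᵛ - η ∷ᵛ []ᵛ) (C ∷ᵛ C ∷ᵛ c ∷ᵛ []ᵛ)

  weight-cong : ∀ {C D} → C ≋ D → ∀ {i j} (π : P i j) → weight C π ≈ weight D π
  weight-cong C≋D ε             = refl
  weight-cong C≋D ((e , _) ◅ π) = +-cong (C≋D e) (weight-cong C≋D π)

  critical-tail : ∀ {C i k j} (x : i ⟶ k) (π : P k j) → Critical C (x ◅ π) → Critical C π
  critical-tail x π crit ρ = +-cancelˡ-≤ _ (crit (x ◅ ρ))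

  critical-≥ : ∀ {C i j} {π : P i j} (ρ : P i j) → Critical C π → weight C π ≤ weight C ρ → Critical C ρ
  critical-≥ ρ crit le σ = ≤-trans (crit σ) le

  ∀-path : ∀ {i j} {Q : Pred (P i j) 0ℓ} → All Q (paths i j) → ∀ π → Q π
  ∀-path all π = All.lookup all (∈-paths π)

  criticalPath : ∀ C {i j} → P i j → ∃ λ (π : P i j) → Critical C π
  criticalPath C {i} {j} π =
    argmax (weight C) π (paths i j) , ∀-path (f[xs]≤f[argmax] π (paths i j))
    where open Extrema totalOrder

  critical? : ∀ C {i j} (π : P i j) → Dec (Critical C π)
  critical? C {i} {j} π =
    map′ ∀-path (λ crit → All.tabulate (λ {ρ} _ → crit ρ))
         (All.all? (λ ρ → weight C ρ ≤? weight C π) (paths i j))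

  -- `Generic` speaks of distinct endpoints only; for equal ones acyclicity leaves a single path.
  unique-critical : ∀ {C} → Generic C → ∀ {i j} (π ρ : P i j) →
                    Critical C π → Critical C ρ → π ≡ ρ
  unique-critical gen {i} {j} π ρ π-crit ρ-crit with i Fin.≟ j
  ... | yes ≡.refl = P-loop π ρ
  ... | no  i≢j with gen i j i≢j π
  ...   | _ , _ , unique = ≡.trans (≡.sym (unique π-crit)) (unique ρ-crit)

  -- The positive counterpart of non-genericity: a tie held as data, from which two points of a face
  -- can be built.
  CriticalFork : WeightMatrix → Set
  CriticalFork C = ∃ λ i → ∃ λ j → ∃ λ (π : P i j) → ∃ λ (ρ : P i j) →
    Critical C π × Critical C ρ × Diverge π ρ

  ¬criticalFork⇒generic : ∀ {C} → ¬ CriticalFork C → Generic C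
  ¬criticalFork⇒generic {C} ¬fork i j _ w with criticalPath C w
  ... | π , π-crit = π , π-crit , λ {ρ} ρ-crit → case compare π ρ of λ where
    (inj₁ π≡ρ) → π≡ρ
    (inj₂ d)   → contradiction (i , j , π , ρ , π-crit , ρ-crit , d) ¬fork

  generic⇒¬criticalFork : ∀ {C} → Generic C → ¬ CriticalFork C
  generic⇒¬criticalFork gen (_ , _ , π , ρ , π-crit , ρ-crit , d)
    with unique-critical gen π ρ π-crit ρ-crit
  ... | ≡.refl = diverge-irrefl d

  diverge? : ∀ {i j} (π ρ : P i j) → Dec (Diverge π ρ)
  diverge? π ρ with compare π ρ
  ... | inj₁ ≡.refl = no diverge-irrefl
  ... | inj₂ d      = yes d

  ∃path? : ∀ {i j} {Q : Pred (P i j) 0ℓ} → (∀ π → Dec (Q π)) → Dec (∃ λ π → Q π)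
  ∃path? {i} {j} Q? =
    map′ Any.satisfied (λ (π , q) → lose (∈-paths π) q) (Any.any? Q? (paths i j))

  criticalFork? : ∀ C → Dec (CriticalFork C)
  criticalFork? C =
    Fin.any? λ i → Fin.any? λ j → ∃path? λ π → ∃path? λ ρ →
      critical? C π ×-dec critical? C ρ ×-dec diverge? π ρ

  infix 4 _⊑_
  _⊑_ : WeightMatrix → WeightMatrix → Set
  C ⊑ D = ∀ {i j} (π : P i j) → Critical C π → Critical D π

  criticalFork-mono : ∀ {C D} → C ⊑ D → CriticalFork C → CriticalFork D
  criticalFork-mono C⊑D (i , j , π , ρ , π-crit , ρ-crit , d) =
    i , j , π , ρ , C⊑D π π-crit , C⊑D ρ ρ-crit , d

  -- Critical paths through `L` destroy critical edges, so fewer critical paths mean more edges,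
  -- more connections and a smaller maxoid.
  criticalEdge-mono : ∀ {C D L i j} → D ⊑ C → CriticalEdge C L i j → CriticalEdge D L i j
  criticalEdge-mono D⊑C (i≢j , π , avoids) = i≢j , π , λ ρ crit → avoids ρ (D⊑C ρ crit)

  connecting-mono : ∀ {C D L i j} → D ⊑ C → Connecting C L i j → Connecting D L i j
  connecting-mono D⊑C (form-a ij) = form-a (criticalEdge-mono D⊑C ij)
  connecting-mono D⊑C (form-b p p∉L p≢i p≢j pi pj) =
    form-b p p∉L p≢i p≢j (criticalEdge-mono D⊑C pi) (criticalEdge-mono D⊑C pj)
  connecting-mono D⊑C (form-c ℓ ℓ∈L iℓ jℓ) =
    form-c ℓ ℓ∈L (criticalEdge-mono D⊑C iℓ) (criticalEdge-mono D⊑C jℓ)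
  connecting-mono D⊑C (form-d p ℓ p∉L ℓ∈L p≢i p≢j pi pℓ jℓ) =
    form-d p ℓ p∉L ℓ∈L p≢i p≢j
      (criticalEdge-mono D⊑C pi) (criticalEdge-mono D⊑C pℓ) (criticalEdge-mono D⊑C jℓ)
  connecting-mono D⊑C (form-e p ℓ q p∉L ℓ∈L q∉L p≢i p≢j q≢i q≢j p≢q pi pℓ qℓ qj) =
    form-e p ℓ q p∉L ℓ∈L q∉L p≢i p≢j q≢i q≢j p≢q
      (criticalEdge-mono D⊑C pi) (criticalEdge-mono D⊑C pℓ)
      (criticalEdge-mono D⊑C qℓ) (criticalEdge-mono D⊑C qj)

  M⋆-antitone : ∀ {C D} → D ⊑ C → ∀ {s} → s ∈ M⋆ D → s ∈ M⋆ C
  M⋆-antitone D⊑C (I∩J , I∩L , J∩L , separated) =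
    I∩J , I∩L , J∩L , λ i j i∈I j∈J connected →
      separated i j i∈I j∈J (Sum.map (connecting-mono D⊑C) (connecting-mono D⊑C) connected)

  M⋆-cong : ∀ {C D} → C ⊑ D → D ⊑ C → M⋆ C ≐ M⋆ D
  M⋆-cong C⊑D D⊑C = M⋆-antitone C⊑D , M⋆-antitone D⊑C

  -- Recovering the critical paths from a generic maxoid.

  below : V → V → Subset #V
  below ℓ i = Vec.tabulate (λ x → does (reachable? x ℓ ×-dec ¬? (x Fin.≟ i)))

  ∈-below⁺ : ∀ {ℓ i x} → P x ℓ → x ≢ i → x ∈ₛ below ℓ i
  ∈-below⁺ {ℓ} {i} {x} x≤ℓ x≢i = Vecₚ.lookup⇒[]= x _
    (≡.trans (Vecₚ.lookup∘tabulate _ x)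
             (dec-true (reachable? x ℓ ×-dec ¬? (x Fin.≟ i)) (x≤ℓ , x≢i)))

  ∈-below⁻ : ∀ {ℓ i x} → x ∈ₛ below ℓ i → P x ℓ × x ≢ i
  ∈-below⁻ {ℓ} {i} {x} x∈ = decidable-stable x∈? λ x∉ →
    case ≡.trans (≡.sym (Vecₚ.[]=⇒lookup x∈))
                 (≡.trans (Vecₚ.lookup∘tabulate _ x) (dec-false x∈? x∉)) of λ ()
    where
    x∈? : Dec (P x ℓ × x ≢ i)
    x∈? = reachable? x ℓ ×-dec ¬? (x Fin.≟ i)

  -- Every p in the forms (b), (d) and (e) that points to i or into L lies in L
  -- itself, and j points to no node of L; so only the direct edge (a) matters.
  module _ {C D : WeightMatrix} {i ℓ k j : V} (x : i ⟶ ℓ) (y : i ⟶ k)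
           (π : P ℓ j) (ρ : P k j) (k≰ℓ : ¬ P k ℓ) where

    private
      L = below ℓ i
      s = [ ⁅ i ⁆ ⫫ ⁅ j ⁆ ∣ L ]

      i≤ℓ : P i ℓ
      i≤ℓ = x ◅ ε

      j≰ℓ : ¬ P j ℓ
      j≰ℓ j≤ℓ = k≰ℓ (ρ ◅◅ j≤ℓ)

      i≢j : i ≢ j
      i≢j ≡.refl = j≰ℓ i≤ℓ

      ℓ∈L : ℓ ∈ₛ L
      ℓ∈L = ∈-below⁺ ε (λ where ≡.refl → no-return x ε)

      parent∈L : ∀ {p} {M} → CriticalEdge M L p i → p ∈ₛ L
      parent∈L (p≢i , p≤i , _) = ∈-below⁺ (p≤i ◅◅ i≤ℓ) p≢i

      grandparent∈L : ∀ {p l M} → l ∈ₛ L → p ≢ i → CriticalEdge M L p l → p ∈ₛ L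
      grandparent∈L l∈L p≢i (_ , p≤l , _) = ∈-below⁺ (p≤l ◅◅ proj₁ (∈-below⁻ l∈L)) p≢i

      j↛L : ∀ {l M} → l ∈ₛ L → ¬ CriticalEdge M L j l
      j↛L l∈L (_ , j≤l , _) = j≰ℓ (j≤l ◅◅ proj₁ (∈-below⁻ l∈L))

    -- The head `ℓ` differs from the endpoint `j`, which cannot reach `ℓ`. The helper `go`
    -- generalises `j`, a fixed module parameter, so that the path can be matched.
    head∈interior : ℓ ∈ₗ interiorNodes (x ◅ π)
    head∈interior = go π j≰ℓ
      where
      go : ∀ {j} (π : P ℓ j) → ¬ P j ℓ → ℓ ∈ₗ interiorNodes (x ◅ π)
      go ε       j≰ℓ = contradiction ε j≰ℓ
      go (_ ◅ _) j≰ℓ = here ≡.refl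

    separated : Critical C (x ◅ π) → ¬ Connected C L i j
    separated crit (inj₁ (form-a (_ , _ , avoids))) = avoids (x ◅ π) crit ℓ head∈interior ℓ∈L
    separated crit (inj₁ (form-b p p∉L _ _ pi _))                = p∉L (parent∈L pi)
    separated crit (inj₁ (form-c l l∈L _ jl))                    = j↛L l∈L jl
    separated crit (inj₁ (form-d p l p∉L _ _ _ pi _ _))          = p∉L (parent∈L pi)
    separated crit (inj₁ (form-e p _ _ p∉L _ _ _ _ _ _ _ pi _ _ _)) = p∉L (parent∈L pi)
    separated crit (inj₂ (form-a (_ , j≤i , _)))                 = j≰ℓ (j≤i ◅◅ i≤ℓ)
    separated crit (inj₂ (form-b p p∉L _ _ _ pi))                = p∉L (parent∈L pi)
    separated crit (inj₂ (form-c l l∈L jl _))                    = j↛L l∈L jl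
    separated crit (inj₂ (form-d p l p∉L l∈L _ p≢i _ pl _))      = p∉L (grandparent∈L l∈L p≢i pl)
    separated crit (inj₂ (form-e _ _ q _ _ q∉L _ _ _ _ _ _ _ _ qi)) = q∉L (parent∈L qi)

    ∈-M⋆ : Critical C (x ◅ π) → s ∈ M⋆ C
    ∈-M⋆ crit =
        (λ (v , v∈) → let v∈I , v∈J = x∈p∩q⁻ _ _ v∈ in
           i≢j (≡.trans (≡.sym (x∈⁅y⁆⇒x≡y i v∈I)) (x∈⁅y⁆⇒x≡y j v∈J)))
      , (λ (v , v∈) → let v∈I , v∈L = x∈p∩q⁻ _ _ v∈ in
           proj₂ (∈-below⁻ v∈L) (x∈⁅y⁆⇒x≡y i v∈I))
      , (λ (v , v∈) → let v∈J , v∈L = x∈p∩q⁻ _ _ v∈ in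
           j≰ℓ (≡.subst (λ v → P v ℓ) (x∈⁅y⁆⇒x≡y j v∈J) (proj₁ (∈-below⁻ v∈L))))
      , λ i′ j′ i′∈I j′∈J → ≡.subst₂ (λ i′ j′ → ¬ Connected C L i′ j′)
          (≡.sym (x∈⁅y⁆⇒x≡y i i′∈I)) (≡.sym (x∈⁅y⁆⇒x≡y j j′∈J)) (separated crit)

    -- The edge from `i` to `j` requires every critical path to avoid `L`; genericity reduces this
    -- to `y ◅ ρ`. Its interior nodes are reachable from `k`, and one in `L` would make `k` an
    -- ancestor of `ℓ`.
    ∉-M⋆ : Generic D → Critical D (y ◅ ρ) → ¬ s ∈ M⋆ D
    ∉-M⋆ gen crit (_ , _ , _ , separated) =
      separated i j (x∈⁅x⁆ i) (x∈⁅x⁆ j) (inj₁ (form-a (i≢j , y ◅ ρ , avoids)))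
      where
      avoids : ∀ σ → Critical D σ → ∀ v → v ∈ₗ interiorNodes σ → v ∉ₛ L
      avoids σ σ-crit v v∈σ v∈L with unique-critical gen (y ◅ ρ) σ crit σ-crit
      ... | ≡.refl = k≰ℓ (interior-reachable y ρ v∈σ ◅◅ proj₁ (∈-below⁻ v∈L))

  heads-distinct : ∀ {i k l} {x : i ⟶ k} {y : i ⟶ l} → proj₁ x ≢ proj₁ y → k ≢ l
  heads-distinct {x = e , ≡.refl , ≡.refl} {e′ , s , ≡.refl} e≢e′ t≡t′ = e≢e′ (simple (≡.sym s) t≡t′)

  -- Tails of critical paths are critical, so a common initial segment can be cut off. At the fork
  -- the heads are distinct, hence one of them does not reach the other, and this decides which
  -- matrix separates and which connects.
  M⋆-separates : ∀ {C D} → Generic C → Generic D → ∀ {i j} {π ρ : P i j} →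
                 Critical C π → Critical D ρ → Diverge π ρ → ¬ (M⋆ C ≐ M⋆ D)
  M⋆-separates gC gD π-crit ρ-crit (step {x = x} {π} {ρ} d) =
    M⋆-separates gC gD (critical-tail x π π-crit) (critical-tail x ρ ρ-crit) d
  M⋆-separates {C} {D} gC gD π-crit ρ-crit (fork {k = k} {l} {x} {y} {π} {ρ} x≢y) (C⊆D , D⊆C)
    with reachable? l k
  ... | no  l≰k = ∉-M⋆ {C} {D} x y π ρ l≰k gD ρ-crit (C⊆D (∈-M⋆ {C} {D} x y π ρ l≰k π-crit))
  ... | yes l≤k = ∉-M⋆ {D} {C} y x ρ π k≰l gC π-crit (D⊆C (∈-M⋆ {D} {C} y x ρ π k≰l ρ-crit))
    where
    k≰l : ¬ P k l
    k≰l k≤l = heads-distinct {x = x} {y} x≢y (P-antisym k≤l l≤k)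

  M⋆-determines : ∀ {C D} → Generic C → Generic D → M⋆ C ≐ M⋆ D → C ⊑ D
  M⋆-determines {C} {D} gC gD eq π π-crit with criticalPath D π
  ... | ρ , ρ-crit with compare π ρ
  ...   | inj₁ ≡.refl = ρ-crit
  ...   | inj₂ d      = contradiction eq (M⋆-separates gC gD π-crit ρ-crit d)

-- The maxoid polytope, tested by linear functionals.

module PathPolytope (ℝ : RealField) (G : DAG) where
  open RealField ℝ hiding (zero)
  open OrderedField ℝ
  open Paths G
  open PathProperties G
  open Maxoids ℝ G
  open Polynomials ℝ #E
  open ConvexGeometry ℝ #E
  open CriticalPaths ℝ G
  open RingProperties ring using (+-cancelˡ; +-inverseˡ-unique)
  open MonoidMult +-monoid using (×-homo-+) renaming (_×_ to _·_)
  open SemiringSum semiring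
    using (sum; sum-cong-≋; sum-replicate-zero; ∑-distrib-+)
  open ≤-Reasoning

  -- A unit vector, written in the shape that `toPoint` gives to the exponent of `variableTerm`. It
  -- also serves as a weight matrix and as the functional reading off a coordinate.
  indicator : ∀ {n} → Fin n → Vector Carrier n
  indicator e e′ = (if does (e Fin.≟ e′) then 1 else 0) · 1#

  sum-indicator : ∀ {n} (c : Vector Carrier n) e → sum (λ e′ → c e′ * indicator e e′) ≈ c e
  sum-indicator {suc n} c zero = begin-equality
    c zero * (1# + 0#) + sum (λ e → c (suc e) * 0#)
      ≈⟨ +-cong (trans (*-congˡ (+-identityʳ 1#)) (*-identityʳ (c zero)))
                (trans (sum-cong-≋ (λ e → zeroʳ (c (suc e)))) (sum-replicate-zero n)) ⟩
    c zero + 0#  ≈⟨ +-identityʳ (c zero) ⟩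
    c zero       ∎
  sum-indicator {suc n} c (suc e) = begin-equality
    c zero * 0# + sum (λ e′ → c (suc e′) * indicator e e′)
      ≈⟨ +-cong (zeroʳ (c zero)) (sum-indicator (λ e′ → c (suc e′)) e) ⟩
    0# + c (suc e)  ≈⟨ +-identityˡ (c (suc e)) ⟩
    c (suc e)       ∎

  ⟨indicator,_⟩ : ∀ x e → ⟨ indicator e , x ⟩ ≈ x e
  ⟨indicator, x ⟩ e =
    trans (sum-cong-≋ (λ e′ → *-comm (indicator e e′) (x e′))) (sum-indicator x e)

  indicator-same : ∀ {n} (e : Fin n) → indicator e e ≈ 1#
  indicator-same e rewrite dec-true (e Fin.≟ e) ≡.refl = +-identityʳ 1#

  indicator-other : ∀ {n} {e e′ : Fin n} → e ≢ e′ → indicator e e′ ≈ 0#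
  indicator-other {e = e} {e′} e≢e′ rewrite dec-false (e Fin.≟ e′) e≢e′ = refl

  indicator-nonNegative : ∀ {n} (e e′ : Fin n) → 0# ≤ indicator e e′
  indicator-nonNegative e e′ with e Fin.≟ e′
  ... | yes _ = ≤-trans (proj₁ 0<1) (≤-reflexive (sym (+-identityʳ 1#)))
  ... | no  _ = ≤-refl

  ⟨⟩-negˡ : ∀ c x → ⟨ (λ e → - c e) , x ⟩ ≈ - ⟨ c , x ⟩
  ⟨⟩-negˡ c x = +-inverseˡ-unique _ _ (begin-equality
    ⟨ (λ e → - c e) , x ⟩ + ⟨ c , x ⟩       ≈⟨ ∑-distrib-+ (λ e → - c e * x e) (λ e → c e * x e) ⟨
    sum (λ e → - c e * x e + c e * x e)     ≈⟨ sum-cong-≋ (λ e → distribʳ (x e) (- c e) (c e)) ⟨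
    sum (λ e → (- c e + c e) * x e)         ≈⟨ sum-cong-≋ (λ e → trans (*-congʳ (-‿inverseˡ (c e))) (zeroˡ (x e))) ⟩
    sum {#E} (λ _ → 0#)                     ≈⟨ sum-replicate-zero #E ⟩
    0#                                      ∎)

  pathPoint : ∀ {i j} → P i j → Space
  pathPoint π = toPoint (proj₂ (pathTerm π))

  -- Each edge of the path adds its unit vector to the exponent, and the unit vector of `e` pairs
  -- with `c` to `c e`.
  ⟨⟩-pathPoint : ∀ c {i j} (π : P i j) → ⟨ c , pathPoint π ⟩ ≈ weight c π
  ⟨⟩-pathPoint c ε = trans
    (⟨⟩-congʳ c (λ e → reflexive (≡.cong (_· 1#) (Vecₚ.lookup-replicate e 0))))
    (⟨⟩-zeroʳ c)
  ⟨⟩-pathPoint c ((e , x) ◅ π) = begin-equality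
    ⟨ c , pathPoint ((e , x) ◅ π) ⟩
      ≈⟨ ⟨⟩-congʳ c split ⟩
    ⟨ c , (λ e′ → indicator e e′ + pathPoint π e′) ⟩
      ≈⟨ ⟨⟩-+ʳ c (indicator e) (pathPoint π) ⟩
    ⟨ c , indicator e ⟩ + ⟨ c , pathPoint π ⟩
      ≈⟨ +-cong (sum-indicator c e) (⟨⟩-pathPoint c π) ⟩
    c e + weight c π  ∎
    where
    u v : Exponent
    u = proj₂ (variableTerm e)
    v = proj₂ (pathTerm π)

    split : ∀ e′ → Vec.lookup (Vec.zipWith ℕ._+_ u v) e′ · 1# ≈ indicator e e′ + pathPoint π e′
    split e′ = begin-equality
      Vec.lookup (Vec.zipWith ℕ._+_ u v) e′ · 1#
        ≈⟨ reflexive (≡.cong (_· 1#) (Vecₚ.lookup-zipWith ℕ._+_ e′ u v)) ⟩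
      (Vec.lookup u e′ ℕ.+ Vec.lookup v e′) · 1#
        ≈⟨ ×-homo-+ 1# (Vec.lookup u e′) (Vec.lookup v e′) ⟩
      Vec.lookup u e′ · 1# + pathPoint π e′
        ≈⟨ +-congʳ (reflexive (≡.cong (_· 1#) (Vecₚ.lookup∘tabulate _ e′))) ⟩
      indicator e e′ + pathPoint π e′  ∎

  pathTerm-coefficient : ∀ {i j} (π : P i j) → proj₁ (pathTerm π) ≈ 1#
  pathTerm-coefficient ε       = refl
  pathTerm-coefficient (_ ◅ π) = trans (*-identityˡ _) (pathTerm-coefficient π)

  coefficient-nonNegative : ∀ {i j} (πs : List (P i j)) u →
                            0# ≤ coefficient (map pathTerm πs) u
  coefficient-nonNegative []       u = ≤-refl
  coefficient-nonNegative (π ∷ πs) u with Vecₚ.≡-dec ℕₚ._≟_ (proj₂ (pathTerm π)) u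
  ... | no  _ = coefficient-nonNegative πs u
  ... | yes _ = begin
    0#                                                       ≈⟨ +-identityˡ 0# ⟨
    0# + 0#                                                  ≤⟨ +-mono-≤ 0≤term (coefficient-nonNegative πs u) ⟩
    proj₁ (pathTerm π) + coefficient (map pathTerm πs) u     ∎
    where
    0≤term : 0# ≤ proj₁ (pathTerm π)
    0≤term = ≤-trans (proj₁ 0<1) (≤-reflexive (sym (pathTerm-coefficient π)))

  -- Every term has coefficient one, so collecting equal exponents cannot cancel anything and the
  -- exponent of a listed path stays in the support.
  coefficient-positive : ∀ {i j} {π : P i j} {πs} → π ∈ₗ πs →
                         0# < coefficient (map pathTerm πs) (proj₂ (pathTerm π))
  coefficient-positive {π = π} {ρ ∷ ρs} π∈
    with Vecₚ.≡-dec ℕₚ._≟_ (proj₂ (pathTerm ρ)) (proj₂ (pathTerm π)) | π∈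
  ... | yes _ | _           = begin-strict
    0#                                                       ≈⟨ +-identityˡ 0# ⟨
    0# + 0#                                                  <⟨ +-mono-<-≤ 0<term (coefficient-nonNegative ρs _) ⟩
    proj₁ (pathTerm ρ) + coefficient (map pathTerm ρs) _     ∎
    where
    0<term : 0# < proj₁ (pathTerm ρ)
    0<term = <-≤-trans 0<1 (≤-reflexive (sym (pathTerm-coefficient ρ)))
  ... | no u≢u | here ≡.refl = contradiction ≡.refl u≢u
  ... | no _   | there π∈ρs  = coefficient-positive π∈ρs

  coefficient-support : ∀ {i j} (πs : List (P i j)) u → ¬ (coefficient (map pathTerm πs) u ≈ 0#) →
                        ∃ λ (π : P i j) → proj₂ (pathTerm π) ≡ u
  coefficient-support []       u ≉0 = contradiction refl ≉0
  coefficient-support (π ∷ πs) u ≉0 with Vecₚ.≡-dec ℕₚ._≟_ (proj₂ (pathTerm π)) u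
  ... | yes eq = π , eq
  ... | no  _  = coefficient-support πs u ≉0

  pathPoint∈Newt : ∀ {i j} (π : P i j) → pathPoint π ∈ Newt (pathPolynomial i j)
  pathPoint∈Newt π =
      1 , (λ _ → 1#) , (λ _ → pathPoint π)
    , (λ _ → _ , (λ eq → proj₂ (coefficient-positive (∈-paths π)) (sym eq)) , λ _ → refl)
    , (λ _ → proj₁ 0<1)
    , +-identityʳ 1#
    , λ e → sym (trans (+-identityʳ _) (*-identityˡ _))

  -- The coefficients and paths are chosen before `c`, so that two functionals can be compared on
  -- one and the same average.
  Newt-average : ∀ {i j x} → x ∈ Newt (pathPolynomial i j) →
    ∃ λ k → Σ (Vector Carrier k) λ a → Σ (Vector (P i j) k) λ π →
      (∀ s → 0# ≤ a s) × sum a ≈ 1# × (∀ c → ⟨ c , x ⟩ ≈ sum (λ s → a s * weight c (π s)))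
  Newt-average {i} {j} {x} (k , a , p , p∈ , 0≤a , Σa≈1 , x≋) =
    k , a , proj₁ ∘ vertex , 0≤a , Σa≈1 , λ c → begin-equality
      ⟨ c , x ⟩                                         ≈⟨ ⟨⟩-congʳ c x≋ ⟩
      ⟨ c , linearCombination a p ⟩                     ≈⟨ ⟨⟩-linearCombination c a p ⟩
      sum (λ s → a s * ⟨ c , p s ⟩)                     ≈⟨ sum-cong-≋ (λ s → *-congˡ (value c s)) ⟩
      sum (λ s → a s * weight c (proj₁ (vertex s)))     ∎
    where
    vertex : ∀ s → ∃ λ (π : P i j) → p s ≋ pathPoint π
    vertex s with p∈ s
    ... | u , ≉0 , ps≋u with coefficient-support (paths i j) u ≉0
    ...   | π , ≡.refl = π , ps≋u

    value : ∀ c s → ⟨ c , p s ⟩ ≈ weight c (proj₁ (vertex s))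
    value c s = trans (⟨⟩-congʳ c (proj₂ (vertex s))) (⟨⟩-pathPoint c (proj₁ (vertex s)))

  Newt-≤ : ∀ {i j x c B} → x ∈ Newt (pathPolynomial i j) →
           (∀ (π : P i j) → weight c π ≤ B) → ⟨ c , x ⟩ ≤ B
  Newt-≤ {c = c} x∈ bound with Newt-average x∈
  ... | _ , a , π , 0≤a , Σa≈1 , avg =
    ≤-trans (≤-reflexive (avg c)) (average-≤ (λ s → bound (π s)))
    where open Average a 0≤a Σa≈1

  -- An average reaching the upper bound `B` charges only paths of `c`-weight `B`, and on those `d`
  -- is at least `D`.
  Newt-≥ : ∀ {i j x c d B D} → x ∈ Newt (pathPolynomial i j) →
           (∀ (π : P i j) → weight c π ≤ B) → B ≤ ⟨ c , x ⟩ →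
           (∀ (π : P i j) → B ≤ weight c π → D ≤ weight d π) → D ≤ ⟨ d , x ⟩
  Newt-≥ {c = c} {d} x∈ bound attained impl with Newt-average x∈
  ... | _ , a , π , 0≤a , Σa≈1 , avg =
    ≤-trans (average-≥ (λ s → bound (π s)) (≤-trans attained (≤-reflexive (avg c)))
                       (λ s → impl (π s)))
            (≤-reflexive (sym (avg d)))
    where open Average a 0≤a Σa≈1

  -- `All Path ps` is a choice of one path per pair; the sums of the chosen exponent vectors are the
  -- test points of the Minkowski sum.
  Path : V × V → Set
  Path (i , j) = P i j

  NewtonSum : List (V × V) → Pred Space 0ℓ
  NewtonSum ps = minkowskiSum (map (λ (i , j) → Newt (pathPolynomial i j)) ps)

  Each : (∀ {i j} → Pred (P i j) 0ℓ) → ∀ {ps} → All Path ps → Set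
  Each K []      = ⊤
  Each K (π ∷ χ) = K π × Each K χ

  each-map : ∀ {K L : ∀ {i j} → Pred (P i j) 0ℓ} → (∀ {i j} (π : P i j) → K π → L π) →
             ∀ {ps} (χ : All Path ps) → Each K χ → Each L χ
  each-map f []      _          = _
  each-map f (π ∷ χ) (Kπ , Kχ) = f π Kπ , each-map f χ Kχ

  each-update : ∀ {K : ∀ {i j} → Pred (P i j) 0ℓ} {ps} (χ : All Path ps) {i j}
                (m : (i , j) ∈ₗ ps) {π : P i j} →
                Each K χ → K π → Each K (χ [ m ]≔ π)
  each-update (_ ∷ χ) (here ≡.refl) (_ , Kχ)  Kπ = Kπ , Kχ
  each-update (_ ∷ χ) (there m)     (Kρ , Kχ) Kπ = Kρ , each-update χ m Kχ Kπ

  point : ∀ {ps} → All Path ps → Space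
  point []      = λ _ → 0#
  point (π ∷ χ) = λ e → pathPoint π e + point χ e

  total : ∀ {ps} → WeightMatrix → All Path ps → Carrier
  total c []      = 0#
  total c (π ∷ χ) = weight c π + total c χ

  ⟨⟩-point : ∀ c {ps} (χ : All Path ps) → ⟨ c , point χ ⟩ ≈ total c χ
  ⟨⟩-point c []      = ⟨⟩-zeroʳ c
  ⟨⟩-point c (π ∷ χ) =
    trans (⟨⟩-+ʳ c (pathPoint π) (point χ)) (+-cong (⟨⟩-pathPoint c π) (⟨⟩-point c χ))

  point∈NewtonSum : ∀ {ps} (χ : All Path ps) → point χ ∈ NewtonSum ps
  point∈NewtonSum []      = λ _ → refl
  point∈NewtonSum (π ∷ χ) = _ , _ , pathPoint∈Newt π , point∈NewtonSum χ , λ _ → refl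

  NewtonSum-resp-≋ : ∀ ps {x y} → x ≋ y → y ∈ NewtonSum ps → x ∈ NewtonSum ps
  NewtonSum-resp-≋ []       x≋y y≋0 = λ e → trans (x≋y e) (y≋0 e)
  NewtonSum-resp-≋ (_ ∷ ps) x≋y (s , t , s∈ , t∈ , y≋) =
    s , t , s∈ , t∈ , λ e → trans (x≋y e) (y≋ e)

  NewtonSum-≤ : ∀ {c ps} (χ : All Path ps) → Each (Critical c) χ →
                ∀ {x} → x ∈ NewtonSum ps → ⟨ c , x ⟩ ≤ total c χ
  NewtonSum-≤ {c} []      _             x≋0 =
    ≤-reflexive (trans (⟨⟩-congʳ c x≋0) (⟨⟩-zeroʳ c))
  NewtonSum-≤ {c} (π ∷ χ) (crit , crits) {x} (s , t , s∈ , t∈ , x≋) = begin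
    ⟨ c , x ⟩                ≈⟨ trans (⟨⟩-congʳ c x≋) (⟨⟩-+ʳ c s t) ⟩
    ⟨ c , s ⟩ + ⟨ c , t ⟩    ≤⟨ +-mono-≤ (Newt-≤ s∈ crit) (NewtonSum-≤ χ crits t∈) ⟩
    weight c π + total c χ   ∎

  -- The common form of two situations: all `c`-critical paths are also `d`-critical, or there is
  -- only one of them.
  LightestCritical : WeightMatrix → WeightMatrix → ∀ {i j} → Pred (P i j) 0ℓ
  LightestCritical c d {i} {j} π = (ρ : P i j) → Critical c ρ → weight d π ≤ weight d ρ

  -- No summand of `x` exceeds its critical weight for `c`, yet the total is reached, so every
  -- summand is maximal and `Newt-≥` applies to each.
  NewtonSum-≥ : ∀ {c d ps} (χ : All Path ps) → Each (Critical c) χ →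
                ∀ {x} → x ∈ NewtonSum ps → total c χ ≤ ⟨ c , x ⟩ →
                Each (LightestCritical c d) χ → total d χ ≤ ⟨ d , x ⟩
  NewtonSum-≥ {d = d} []      _ x≋0 _ _ =
    ≤-reflexive (sym (trans (⟨⟩-congʳ d x≋0) (⟨⟩-zeroʳ d)))
  NewtonSum-≥ {c} {d} (π ∷ χ) (crit , crits) {x} (s , t , s∈ , t∈ , x≋) le (light , lights) = begin
    weight d π + total d χ   ≤⟨ +-mono-≤ d[s] d[t] ⟩
    ⟨ d , s ⟩ + ⟨ d , t ⟩    ≈⟨ trans (⟨⟩-congʳ d x≋) (⟨⟩-+ʳ d s t) ⟨
    ⟨ d , x ⟩                ∎
    where
    le′ : weight c π + total c χ ≤ ⟨ c , s ⟩ + ⟨ c , t ⟩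
    le′ = ≤-trans le (≤-reflexive (trans (⟨⟩-congʳ c x≋) (⟨⟩-+ʳ c s t)))

    s≤ : ⟨ c , s ⟩ ≤ weight c π
    s≤ = Newt-≤ s∈ crit

    t≤ : ⟨ c , t ⟩ ≤ total c χ
    t≤ = NewtonSum-≤ χ crits t∈

    d[s] : weight d π ≤ ⟨ d , s ⟩
    d[s] = Newt-≥ {d = d} s∈ crit (+-tightˡ s≤ t≤ le′) (λ ρ w → light ρ (critical-≥ {π = π} ρ crit w))

    d[t] : total d χ ≤ ⟨ d , t ⟩
    d[t] = NewtonSum-≥ χ crits t∈ (+-tightʳ s≤ t≤ le′) lights

  -- Both sides consist of `π`, `ρ` and the paths chosen at the other positions. The additive form
  -- isolates one pair without subtracting.
  exchange : ∀ c {ps} (χ : All Path ps) {i j} (m : (i , j) ∈ₗ ps) (π ρ : P i j) →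
             total c (χ [ m ]≔ π) + weight c ρ ≈ total c (χ [ m ]≔ ρ) + weight c π
  exchange c (_ ∷ χ) (here ≡.refl) π ρ = begin-equality
    weight c π + total c χ + weight c ρ    ≈⟨ +-comm _ (weight c ρ) ⟩
    weight c ρ + (weight c π + total c χ)  ≈⟨ +-congˡ (+-comm (weight c π) (total c χ)) ⟩
    weight c ρ + (total c χ + weight c π)  ≈⟨ +-assoc _ _ _ ⟨
    weight c ρ + total c χ + weight c π    ∎
  exchange c (σ ∷ χ) (there m) π ρ = begin-equality
    weight c σ + total c (χ [ m ]≔ π) + weight c ρ    ≈⟨ +-assoc _ _ _ ⟩
    weight c σ + (total c (χ [ m ]≔ π) + weight c ρ)  ≈⟨ +-congˡ (exchange c χ m π ρ) ⟩
    weight c σ + (total c (χ [ m ]≔ ρ) + weight c π)  ≈⟨ +-assoc _ _ _ ⟨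
    weight c σ + total c (χ [ m ]≔ ρ) + weight c π    ∎

  indicator-nonNegative-weight : ∀ e {i j} (π : P i j) → 0# ≤ weight (indicator e) π
  indicator-nonNegative-weight e ε              = ≤-refl
  indicator-nonNegative-weight e ((e′ , _) ◅ π) = ≤-trans (≤-reflexive (sym (+-identityˡ 0#)))
    (+-mono-≤ (indicator-nonNegative e e′) (indicator-nonNegative-weight e π))

  indicator-unreachable : ∀ {e i j} (π : P i j) → ¬ P i (source e) → weight (indicator e) π ≈ 0#
  indicator-unreachable ε _ = refl
  indicator-unreachable {e} (x@(e′ , s , _) ◅ π) i≰s = begin-equality
    indicator e e′ + weight (indicator e) π
      ≈⟨ +-cong (indicator-other e≢e′) (indicator-unreachable π (λ k≤s → i≰s (x ◅ k≤s))) ⟩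
    0# + 0#  ≈⟨ +-identityˡ 0# ⟩
    0#       ∎
    where
    e≢e′ : e ≢ e′
    e≢e′ ≡.refl = i≰s (≡.subst (P _) (≡.sym s) ε)

  -- The first edge of π after a fork is not on ρ.
  diverge-edge : ∀ {i j} {π ρ : P i j} → Diverge π ρ →
                 ∃ λ e → ¬ (weight (indicator e) π ≈ weight (indicator e) ρ)
  diverge-edge (step {x = e′ , _} d) with diverge-edge d
  ... | e , ≉ = e , λ eq → ≉ (+-cancelˡ (indicator e e′) _ _ eq)
  diverge-edge (fork {x = e , s , t} {y@(e′ , _)} {π} {ρ} e≢e′) = e , λ eq → <⇒≱ 0<1 (begin
    1#                                       ≈⟨ indicator-same e ⟨
    indicator e e                            ≈⟨ +-identityʳ _ ⟨
    indicator e e + 0#                       ≤⟨ +-mono-≤ ≤-refl (indicator-nonNegative-weight e π) ⟩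
    indicator e e + weight (indicator e) π   ≈⟨ eq ⟩
    indicator e e′ + weight (indicator e) ρ
      ≈⟨ +-cong (indicator-other e≢e′) (indicator-unreachable ρ unreachable) ⟩
    0# + 0#                                  ≈⟨ +-identityˡ 0# ⟩
    0#                                       ∎)
    where
    unreachable : ¬ P _ (source e)
    unreachable k≤s = no-return y (≡.subst (P _) s k≤s)

  ∈-connectedPairs : ∀ {i j} → i ≢ j → P i j → (i , j) ∈ₗ connectedPairs
  ∈-connectedPairs {i} {j} i≢j π =
    ∈-filter⁺ _ (∈-cartesianProduct⁺ (∈-allFin i) (∈-allFin j)) (i≢j , nonEmpty (∈-paths π))
    where
    nonEmpty : ∀ {πs : List (P i j)} → π ∈ₗ πs → 1 ℕ.≤ length πs
    nonEmpty {_ ∷ _} _ = ℕ.s≤s ℕ.z≤n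

  -- Supplies the initial path that `criticalPath` starts from, taken from the non-emptiness
  -- recorded by the filter.
  connected-path : All Path connectedPairs
  connected-path = All.map (λ (_ , 1≤length) → path (paths _ _) 1≤length) (all-filter _ (cartesianProduct (allFin #V) (allFin #V)))
    where
    path : ∀ {i j} (πs : List (P i j)) → 1 ℕ.≤ length πs → P i j
    path (π ∷ _) _ = π

  criticalChoice : ∀ c {ps} → All Path ps → ∃ λ (χ : All Path ps) → Each (Critical c) χ
  criticalChoice c []      = [] , _
  criticalChoice c (π ∷ ω) with criticalPath c π | criticalChoice c ω
  ... | ρ , crit | χ , crits = ρ ∷ χ , crit , crits

  criticals : ∀ c → All Path connectedPairs
  criticals c = proj₁ (criticalChoice c connected-path)

  criticals-critical : ∀ c → Each (Critical c) (criticals c)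
  criticals-critical c = proj₂ (criticalChoice c connected-path)

  ∈-face⁺ : ∀ {c x} (χ : All Path connectedPairs) → Each (Critical c) χ → x ∈ maxoidPolytope → total c χ ≤ ⟨ c , x ⟩ →
            x ∈ face c maxoidPolytope
  ∈-face⁺ χ crit x∈ le = x∈ , maximal x∈ (λ y y∈ → ≤-trans (NewtonSum-≤ χ crit y∈) le)

  point∈face : ∀ {c} (χ : All Path connectedPairs) → Each (Critical c) χ → point χ ∈ face c maxoidPolytope
  point∈face χ crit = ∈-face⁺ χ crit (point∈NewtonSum χ) (≤-reflexive (sym (⟨⟩-point _ χ)))

  total≤ : ∀ {c x} (χ : All Path connectedPairs) → IsMax c maxoidPolytope ⟨ c , x ⟩ → total c χ ≤ ⟨ c , x ⟩
  total≤ {c} χ (_ , bound) =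
    ≤-trans (≤-reflexive (sym (⟨⟩-point c χ))) (bound (point χ) (point∈NewtonSum χ))

-- Normal cones of faces and their interiors.

module NormalCones (ℝ : RealField) (G : DAG) where
  open RealField ℝ hiding (zero)
  open OrderedField ℝ
  open Paths G
  open PathProperties G
  open Maxoids ℝ G
  open ConvexGeometry ℝ #E
  open CriticalPaths ℝ G
  open PathPolytope ℝ G
  open RingProperties ring using (+-cancelˡ; //-rightDividesˡ; //-rightDividesʳ)
  open SemiringSum semiring using (sum; sum-cong-≋)
  open ≤-Reasoning

  Faceᶜ : WeightMatrix → Pred Space 0ℓ
  Faceᶜ c = face c maxoidPolytope

  -- A C-critical choice is also D-critical, so its `D`-total is the maximum of `D`. Every
  -- C-critical path has the same `D`-weight as the chosen one, so each point of the face attains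
  -- that total.
  ⊑⇒∈N : ∀ {F C D} → F ≐ Faceᶜ C → C ⊑ D → D ∈ N F
  ⊑⇒∈N {C = C} {D} (F⊆ , _) C⊑D x x∈F with F⊆ x∈F
  ... | x∈Q , C-max = proj₂ (∈-face⁺ χ D-crit x∈Q
          (NewtonSum-≥ χ crit x∈Q (total≤ χ C-max)
            (each-map (λ π π-crit ρ ρ-crit → C⊑D ρ ρ-crit π) χ crit)))
    where
    χ = criticals C
    crit = criticals-critical C
    D-crit : Each (Critical D) χ
    D-crit = each-map C⊑D χ crit

  -- Putting a C-critical `π` into a C-critical choice gives a point of `F`, where `D` is maximal.
  -- Replacing `π` by `ρ` cannot raise the `D`-total, and `exchange` reduces this to the two paths.
  ∈N⇒⊑ : ∀ {F C D} → F ≐ Faceᶜ C → D ∈ N F → C ⊑ D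
  ∈N⇒⊑ {C = C} {D} (_ , ⊆F) D∈N {i} {j} π π-crit ρ with i Fin.≟ j
  ... | yes ≡.refl = ≤-reflexive (reflexive (≡.cong (weight D) (P-loop ρ π)))
  ... | no i≢j = +-cancelˡ-≤ (total D χπ) (begin
      total D χπ + weight D ρ  ≈⟨ exchange D χ m π ρ ⟩
      total D χρ + weight D π  ≤⟨ +-monoˡ-≤ (weight D π) χρ≤χπ ⟩
      total D χπ + weight D π  ∎)
    where
    m = ∈-connectedPairs i≢j π
    χ = criticals C
    χπ = χ [ m ]≔ π
    χρ = χ [ m ]≔ ρ

    χρ≤χπ : total D χρ ≤ total D χπ
    χρ≤χπ = begin
      total D χρ          ≤⟨ total≤ χρ (D∈N (point χπ) (⊆F (point∈face χπ χπ-crit))) ⟩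
      ⟨ D , point χπ ⟩    ≈⟨ ⟨⟩-point D χπ ⟩
      total D χπ          ∎
      where
      χπ-crit : Each (Critical C) χπ
      χπ-crit = each-update χ m (criticals-critical C) π-crit

  -- `C` lies in the cone itself, so the extrapolated matrix stays in the affine hull and, near `D`,
  -- in the cone. There a C-critical `π` still beats `ρ`; as `D` ties them and `C` enters with a
  -- negative factor, `ρ` is no lighter than `π` for `C`.
  relativeInterior⇒⊒ : ∀ {F C D} → F ≐ Faceᶜ C → D ∈ relativeInterior (N F) → D ⊑ C
  relativeInterior⇒⊒ {F} {C} {D} F≐ (D∈N , r , 0<r , ball⊆N) ρ ρ-crit
    with criticalPath C ρ | affineLine∈ball D C 0<r
  ... | π , π-crit | η , 0<η , L∈ball = critical-≥ {π = π} ρ π-crit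
    (extrapolate-reflects 0<η (≤-antisym (π-critᴰ ρ) (ρ-crit π)) (begin
      extrapolate η (weight D ρ) (weight C ρ)  ≈⟨ weight-affineLine η D C ρ ⟨
      weight L ρ                               ≤⟨ ∈N⇒⊑ F≐ L∈N π π-crit ρ ⟩
      weight L π                               ≈⟨ weight-affineLine η D C π ⟩
      extrapolate η (weight D π) (weight C π)  ∎))
    where
    L = affineLine η D C

    π-critᴰ : Critical D π
    π-critᴰ = ∈N⇒⊑ F≐ D∈N π π-crit

    L∈N : L ∈ N F
    L∈N = ball⊆N L (affineLine∈aff η D∈N (⊑⇒∈N F≐ (λ _ crit → crit))) L∈ball

  -- Continuity of the path weight: half of the tolerance goes to the first edge and half to the
  -- rest of the path.
  weight-near : ∀ c {i j} (π : P i j) {r} → 0# < r →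
    c ∈ interior (λ d → weight d π < weight c π + r × weight c π < weight d π + r)
  weight-near c ε             0<r = interior-universal (λ _ → x<x+y 0<r , x<x+y 0<r)
  weight-near c ((e , _) ◅ π) {r} 0<r with halve 0<r
  ... | h , 0<h , h+h≈r = interior-mono combine (interior-∩ (edge-near 0<h) (weight-near c π 0<h))
    where
    EdgeNear : Space → Set
    EdgeNear d = d e < c e + h × c e < d e + h

    edge-near : 0# < h → c ∈ interior EdgeNear
    edge-near 0<h = h , 0<h , λ d d∈ →
        (begin-strict
          d e              ≈⟨ //-rightDividesˡ (c e) (d e) ⟨
          d e - c e + c e  <⟨ +-mono-<-≤ (proj₂ (d∈ e)) ≤-refl ⟩
          h + c e          ≈⟨ +-comm h (c e) ⟩
          c e + h          ∎)
      , (begin-strict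
          c e                      ≈⟨ //-rightDividesʳ h (c e) ⟨
          c e + h - h              ≈⟨ +-comm (c e + h) (- h) ⟩
          - h + (c e + h)          <⟨ +-mono-<-≤ (proj₁ (d∈ e)) ≤-refl ⟩
          d e - c e + (c e + h)    ≈⟨ +-assoc _ (c e) h ⟨
          d e - c e + c e + h      ≈⟨ +-congʳ (//-rightDividesˡ (c e) (d e)) ⟩
          d e + h          ∎)

    combine : ∀ d → EdgeNear d × (weight d π < weight c π + h × weight c π < weight d π + h) →
              d e + weight d π < c e + weight c π + r × c e + weight c π < d e + weight d π + r
    combine d ((d<c , c<d) , (wd<wc , wc<wd)) = add d<c wd<wc , add c<d wc<wd
      where
      add : ∀ {x y u v} → x < y + h → u < v + h → x + u < y + v + r
      add {x} {y} {u} {v} x<y u<v = begin-strict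
        x + u              <⟨ +-mono-< x<y u<v ⟩
        y + h + (v + h)    ≈⟨ interchange y h v h ⟩
        y + v + (h + h)    ≈⟨ +-congˡ h+h≈r ⟩
        y + v + r          ∎
        where open CommutativeSemigroupProperties +-commutativeSemigroup using (interchange)

  <-near : ∀ c {i j} (ρ π : P i j) → weight c ρ < weight c π →
           c ∈ interior (λ d → weight d ρ < weight d π)
  <-near c ρ π ρ<π with halve 0<gap
    where
    0<gap : 0# < weight c π - weight c ρ
    0<gap = begin-strict
      0#                       ≈⟨ -‿inverseʳ (weight c ρ) ⟨
      weight c ρ - weight c ρ  <⟨ +-mono-<-≤ ρ<π ≤-refl ⟩
      weight c π - weight c ρ  ∎
  -- Each of the two weights may move by less than half of the gap between them.
  ... | h , 0<h , h+h≈gap =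
    interior-mono (λ d ((dρ<cρ+h , _) , (_ , cπ<dπ+h)) → +-cancelʳ-< h (begin-strict
        weight d ρ + h                          <⟨ +-mono-<-≤ dρ<cρ+h ≤-refl ⟩
        weight c ρ + h + h                      ≈⟨ +-assoc _ h h ⟩
        weight c ρ + (h + h)                    ≈⟨ +-congˡ h+h≈gap ⟩
        weight c ρ + (weight c π - weight c ρ)  ≈⟨ +-comm _ _ ⟩
        weight c π - weight c ρ + weight c ρ    ≈⟨ //-rightDividesˡ (weight c ρ) (weight c π) ⟩
        weight c π                              <⟨ cπ<dπ+h ⟩
        weight d π + h                          ∎))
      (interior-∩ (weight-near c ρ 0<h) (weight-near c π 0<h))

  PreservesOrder : WeightMatrix → WeightMatrix → Set
  PreservesOrder c d = ∀ i j (ρ π : P i j) → weight c ρ < weight c π → weight d ρ < weight d π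

  -- There are finitely many pairs of paths; a pair that is not strictly ordered at `c` imposes no
  -- condition.
  preservesOrder-near : ∀ c → c ∈ interior (PreservesOrder c)
  preservesOrder-near c =
    interior-mono (λ d near i j ρ π →
        near i (∈-allFin i) j (∈-allFin j) ρ (∈-paths ρ) π (∈-paths π))
      (interior-∀ (allFin #V) λ i → interior-∀ (allFin #V) λ j →
       interior-∀ (paths i j) λ ρ → interior-∀ (paths i j) λ π → near ρ π)
    where
    near : ∀ {i j} (ρ π : P i j) →
           c ∈ interior (λ d → weight c ρ < weight c π → weight d ρ < weight d π)
    near ρ π with weight c π ≤? weight c ρ
    ... | yes π≤ρ = interior-universal (λ _ ρ<π → contradiction π≤ρ (<⇒≱ ρ<π))
    ... | no  π≰ρ = interior-mono (λ _ ρ<π _ → ρ<π) (<-near c ρ π (≰⇒> π≰ρ))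

  -- Near D the paths that are not C-critical stay below those that are, so only
  -- the C-critical ones have to be compared.
  near⇒⊑ : ∀ {C D d} → C ⊑ D → D ⊑ C → PreservesOrder D d →
           (∀ {i j} (π ρ : P i j) → Critical C π → Critical C ρ → weight d ρ ≤ weight d π) →
           C ⊑ d
  near⇒⊑ {C} C⊑D D⊑C preserves balanced π π-crit ρ with critical? C ρ
  ... | yes ρ-crit  = balanced π ρ π-crit ρ-crit
  ... | no  ¬ρ-crit = proj₁ (preserves _ _ ρ π (≰⇒> λ π≤ρ →
    ¬ρ-crit (D⊑C ρ (critical-≥ {π = π} ρ (C⊑D π π-crit) π≤ρ))))

  -- C-critical paths tie for every matrix in the cone, and ties survive linear combinations, so
  -- they tie on the whole affine hull.
  ∈relativeInterior : ∀ {F C D} → F ≐ Faceᶜ C → C ⊑ D → D ⊑ C → D ∈ relativeInterior (N F)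
  ∈relativeInterior {F} {C} {D} F≐ C⊑D D⊑C with preservesOrder-near D
  ... | r , 0<r , preserves = ⊑⇒∈N F≐ C⊑D , r , 0<r , λ d d∈aff d∈ball →
    ⊑⇒∈N F≐ (near⇒⊑ C⊑D D⊑C (preserves d d∈ball) (balanced d∈aff))
    where
    balanced : ∀ {d} → d ∈ aff (N F) →
               ∀ {i j} (π ρ : P i j) → Critical C π → Critical C ρ → weight d ρ ≤ weight d π
    balanced {d} (k , a , p , p∈N , _ , d≋) π ρ π-crit ρ-crit = begin
      weight d ρ                            ≈⟨ expand ρ ⟩
      sum (λ s → a s * weight (p s) ρ)      ≈⟨ sum-cong-≋ (λ s → *-congˡ (≤-antisym
                                                 (∈N⇒⊑ F≐ (p∈N s) π π-crit ρ)
                                                 (∈N⇒⊑ F≐ (p∈N s) ρ ρ-crit π))) ⟩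
      sum (λ s → a s * weight (p s) π)      ≈⟨ expand π ⟨
      weight d π                            ∎
      where
      expand : ∀ {i j} (σ : P i j) → weight d σ ≈ sum (λ s → a s * weight (p s) σ)
      expand σ = trans (weight-cong d≋ σ) (weight-linearCombination a p σ)

  -- With one C-critical path per pair there is no tie to preserve, so a full ball around `D` fits
  -- into the cone.
  ∈interior : ∀ {F C D} → Generic C → F ≐ Faceᶜ C → C ⊑ D → D ⊑ C → D ∈ interior (N F)
  ∈interior {C = C} {D} gen F≐ C⊑D D⊑C =
    interior-mono (λ d preserves → ⊑⇒∈N F≐ (near⇒⊑ C⊑D D⊑C preserves balanced))
      (preservesOrder-near D)
    where
    balanced : ∀ {d i j} (π ρ : P i j) → Critical C π → Critical C ρ → weight d ρ ≤ weight d π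
    balanced {d} π ρ π-crit ρ-crit =
      ≤-reflexive (reflexive (≡.cong (weight d) (unique-critical gen ρ π ρ-crit π-crit)))

  -- Genericity and the dimension of faces.

  -- With unique critical paths, `NewtonSum-≥` holds for every functional `d`. A coordinate and its
  -- negative bound each entry of `x` from both sides.
  generic-face : ∀ {C} → Generic C → singleton (point (criticals C)) ≐ Faceᶜ C
  generic-face {C} gen = singleton⊆ , ⊆singleton
    where
    χ = criticals C
    crit = criticals-critical C

    singleton⊆ : ∀ {x} → x ≋ point χ → x ∈ Faceᶜ C
    singleton⊆ x≋ = ∈-face⁺ χ crit (NewtonSum-resp-≋ connectedPairs x≋ (point∈NewtonSum χ))
      (≤-reflexive (sym (trans (⟨⟩-congʳ C x≋) (⟨⟩-point C χ))))

    ⊆singleton : ∀ {x} → x ∈ Faceᶜ C → x ≋ point χ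
    ⊆singleton {x} (x∈ , C-max) e = ≤-antisym
      (begin
        x e                              ≈⟨ ⟨indicator, x ⟩ e ⟨
        ⟨ indicator e , x ⟩              ≤⟨ neg-cancel-≤ (begin
          - ⟨ indicator e , point χ ⟩         ≈⟨ ⟨⟩-negˡ (indicator e) (point χ) ⟨
          ⟨ (λ e′ → - indicator e e′) , point χ ⟩  ≤⟨ value≤ _ ⟩
          ⟨ (λ e′ → - indicator e e′) , x ⟩   ≈⟨ ⟨⟩-negˡ (indicator e) x ⟩
          - ⟨ indicator e , x ⟩               ∎) ⟩
        ⟨ indicator e , point χ ⟩        ≈⟨ ⟨indicator, point χ ⟩ e ⟩
        point χ e                        ∎)
      (begin
        point χ e                        ≈⟨ ⟨indicator, point χ ⟩ e ⟨
        ⟨ indicator e , point χ ⟩        ≤⟨ value≤ _ ⟩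
        ⟨ indicator e , x ⟩              ≈⟨ ⟨indicator, x ⟩ e ⟩
        x e                              ∎)
      where
      value≤ : ∀ d → ⟨ d , point χ ⟩ ≤ ⟨ d , x ⟩
      value≤ d = ≤-trans (≤-reflexive (⟨⟩-point d χ))
        (NewtonSum-≥ χ crit x∈ (total≤ χ C-max)
          (each-map (λ π π-crit ρ ρ-crit → ≤-reflexive
              (reflexive (≡.cong (weight d) (unique-critical gen π ρ π-crit ρ-crit)))) χ crit))

  -- The two tied paths are put at the same position of one critical choice. By `exchange` the
  -- resulting points differ in an edge coordinate as the paths do.
  fork⇒distinct : ∀ {C} → CriticalFork C →
    Σ Space λ x → Σ Space λ y → x ∈ Faceᶜ C × y ∈ Faceᶜ C × ∃ λ e → ¬ (x e ≈ y e)
  fork⇒distinct {C} (i , j , π , ρ , π-crit , ρ-crit , d) with diverge-edge d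
  ... | e , π≉ρ = point (χ [ m ]≔ π) , point (χ [ m ]≔ ρ) , on-face π-crit , on-face ρ-crit , e , λ eq →
    π≉ρ (sym (+-cancelˡ (total (indicator e) (χ [ m ]≔ π)) _ _ (begin-equality
      total (indicator e) (χ [ m ]≔ π) + weight (indicator e) ρ  ≈⟨ exchange (indicator e) χ m π ρ ⟩
      total (indicator e) (χ [ m ]≔ ρ) + weight (indicator e) π  ≈⟨ +-congʳ (coordinate ρ) ⟨
      point (χ [ m ]≔ ρ) e + weight (indicator e) π              ≈⟨ +-congʳ eq ⟨
      point (χ [ m ]≔ π) e + weight (indicator e) π              ≈⟨ +-congʳ (coordinate π) ⟩
      total (indicator e) (χ [ m ]≔ π) + weight (indicator e) π  ∎)))
    where
    m = ∈-connectedPairs (diverge⇒≢ d) π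
    χ = criticals C

    on-face : ∀ {σ} → Critical C σ → point (χ [ m ]≔ σ) ∈ Faceᶜ C
    on-face σ-crit = point∈face _ (each-update χ m (criticals-critical C) σ-crit)

    coordinate : ∀ σ → point (χ [ m ]≔ σ) e ≈ total (indicator e) (χ [ m ]≔ σ)
    coordinate σ = trans (sym (⟨indicator, point (χ [ m ]≔ σ) ⟩ e)) (⟨⟩-point (indicator e) (χ [ m ]≔ σ))

  -- Normal cones reverse inclusion: `C′` is maximal on all of `F′`, hence on `F`.
  face-⊑ : ∀ {F F′ C C′} → F ≐ Faceᶜ C → F′ ≐ Faceᶜ C′ → (∀ {x} → x ∈ F → x ∈ F′) → C ⊑ C′
  face-⊑ F≐ F′≐ F⊆F′ =
    ∈N⇒⊑ F≐ (λ x x∈F → ⊑⇒∈N F′≐ (λ _ crit → crit) x (F⊆F′ x∈F))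

  vertex⇒generic : ∀ {v C} → singleton v ≐ Faceᶜ C → Generic C
  vertex⇒generic (_ , ⊆v) = ¬criticalFork⇒generic λ branch →
    let x , y , x∈ , y∈ , e , x≉y = fork⇒distinct branch
    in x≉y (trans (⊆v x∈ e) (sym (⊆v y∈ e)))

  positiveDimension⇒¬generic : ∀ {F C} → F ≐ Faceᶜ C → DimAtLeast 1 F → ¬ Generic C
  positiveDimension⇒¬generic (F⊆ , _) (p , p∈F , indep) gen =
    affinelyIndependent⇒distinct p indep λ e →
      trans (proj₂ (generic-face gen) (F⊆ (p∈F zero)) e)
            (sym (proj₂ (generic-face gen) (F⊆ (p∈F (suc zero))) e))

  ¬generic⇒positiveDimension : ∀ {C} → ¬ Generic C → DimAtLeast 1 (Faceᶜ C)
  -- Deciding the tie turns the negated genericity into the two paths from which the points are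
  -- built.
  ¬generic⇒positiveDimension {C} ¬gen with criticalFork? C
  ... | no  ¬branch = contradiction (¬criticalFork⇒generic ¬branch) ¬gen
  ... | yes branch  = let x , y , x∈ , y∈ , e , x≉y = fork⇒distinct branch in
    (x ∷ᵛ y ∷ᵛ []ᵛ)
    , (λ where
         zero       → x∈
         (suc zero) → y∈)
    , distinct⇒affinelyIndependent e x≉y

  generic-⊑ : ∀ {C D} → D ⊑ C → Generic C → Generic D
  generic-⊑ D⊑C gen =
    ¬criticalFork⇒generic λ branch → generic⇒¬criticalFork gen (criticalFork-mono D⊑C branch)

  face-satisfiable : ∀ C → Satisfiable (Faceᶜ C)
  face-satisfiable C = point (criticals C) , point∈face (criticals C) (criticals-critical C)

  relativeInterior⇒M⋆ : ∀ {F C D} → F ≐ Faceᶜ C → D ∈ relativeInterior (N F) → M⋆ D ≐ M⋆ C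
  relativeInterior⇒M⋆ {F} {C} {D} F≐ D∈ =
    M⋆-cong {D} {C} (relativeInterior⇒⊒ F≐ D∈) (∈N⇒⊑ F≐ (proj₁ D∈))

  -- The correspondences between faces and maxoids.

  vertexOf : ∀ C → Generic C → Setoid.Carrier Vertices
  vertexOf C gen = point (criticals C) , (point (criticals C) , λ _ → refl) , C , generic-face gen

  faceOf : ∀ C → ¬ Generic C → Setoid.Carrier Faces≥1
  faceOf C ¬gen =
    Faceᶜ C , (face-satisfiable C , C , ≐-refl) , ¬generic⇒positiveDimension ¬gen

  -- The matrix is read off the proof that `v` is a vertex; `cong` shows that the maxoid does not
  -- depend on that proof.
  vertexMaxoid : Bijection Vertices GenericMaxoids
  vertexMaxoid = record
    { to        = to
    ; cong      = λ {v} {w} → cong {v} {w}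
    ; bijective = (λ {v} {w} → injective {v} {w}) , surjective
    }
    where
    to : Setoid.Carrier Vertices → Setoid.Carrier GenericMaxoids
    to (v , _ , C , v≐) = M⋆ C , C , vertex⇒generic v≐ , ≐-refl

    cong : ∀ {v w} → proj₁ v ≋ proj₁ w → proj₁ (to v) ≐ proj₁ (to w)
    cong {v , _ , C , v≐} {w , _ , D , w≐} v≋w = M⋆-cong {C} {D}
      (face-⊑ v≐ w≐ (λ x≋v e → trans (x≋v e) (v≋w e)))
      (face-⊑ w≐ v≐ (λ x≋w e → trans (x≋w e) (sym (v≋w e))))

    injective : ∀ {v w} → proj₁ (to v) ≐ proj₁ (to w) → proj₁ v ≋ proj₁ w
    -- The inclusion `C ⊑ D` already places `v` on the face of `D`, whose only point is `w`.
    injective {v , _ , C , v≐} {w , _ , D , w≐} M≐ = proj₂ w≐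
      (proj₁ (proj₁ v≐ (λ _ → refl)) , ⊑⇒∈N v≐ C⊑D v (λ _ → refl))
      where
      C⊑D : C ⊑ D
      C⊑D = M⋆-determines (vertex⇒generic v≐) (vertex⇒generic w≐) M≐

    surjective : ∀ M → ∃ λ v → ∀ {w} → proj₁ w ≋ proj₁ v → proj₁ (to w) ≐ proj₁ M
    surjective (M , C , gen , M≐) = vertexOf C gen , λ {w} w≋v →
      ≐-trans (cong {w} {vertexOf C gen} w≋v) (≐-sym M≐)

  -- Injectivity fails here. When a direct edge ties with a longer critical path, it adds no
  -- interior node, so the maxoid does not notice it. In two disjoint triangles with the longer path
  -- critical, a tie in the first only and a tie in the second only give different faces with the
  -- same maxoid.
  faceMaxoid : Surjection Faces≥1 NonGenericMaxoids
  faceMaxoid = record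
    { to         = to
    ; cong       = λ {F} {F′} → cong {F} {F′}
    ; surjective = surjective
    }
    where
    to : Setoid.Carrier Faces≥1 → Setoid.Carrier NonGenericMaxoids
    to (F , (_ , C , F≐) , dim) = M⋆ C , C , positiveDimension⇒¬generic F≐ dim , ≐-refl

    cong : ∀ {F F′} → proj₁ F ≐ proj₁ F′ → proj₁ (to F) ≐ proj₁ (to F′)
    cong {F , (_ , C , F≐) , _} {F′ , (_ , D , F′≐) , _} (F⊆F′ , F′⊆F) =
      M⋆-cong {C} {D} (face-⊑ F≐ F′≐ F⊆F′) (face-⊑ F′≐ F≐ F′⊆F)

    surjective : ∀ M → ∃ λ F → ∀ {F′} → proj₁ F′ ≐ proj₁ F → proj₁ (to F′) ≐ proj₁ M
    surjective (M , C , ¬gen , M≐) = faceOf C ¬gen , λ {F′} F′≐F →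
      ≐-trans (cong {F′} {faceOf C ¬gen} F′≐F) (≐-sym M≐)

corollary3p2 : (ℝ : RealField) (G : DAG) →
    let open Maxoids ℝ G in
    (Σ (Bijection Vertices GenericMaxoids) λ φ →
    ((v : Setoid.Carrier Vertices) →
    Satisfiable (interior (N (singleton (proj₁ v)))) ×
    (∀ C → C ∈ interior (N (singleton (proj₁ v))) →
    Generic C × M⋆ C ≐ proj₁ (Bijection.to φ v))) ×
    (∀ C → Generic C →
    Σ (Setoid.Carrier Vertices) λ v → C ∈ interior (N (singleton (proj₁ v))))) ×
    (Σ (Surjection Faces≥1 NonGenericMaxoids) λ ψ →
    ((F : Setoid.Carrier Faces≥1) →
    Satisfiable (relativeInterior (N (proj₁ F))) ×
    (∀ C → C ∈ relativeInterior (N (proj₁ F)) →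
    ¬ Generic C × M⋆ C ≐ proj₁ (Surjection.to ψ F))) ×
    (∀ C → ¬ Generic C →
    Σ (Setoid.Carrier Faces≥1) λ F → C ∈ relativeInterior (N (proj₁ F))))
corollary3p2 ℝ G =
    ( vertexMaxoid
    , (λ (v , _ , C , v≐) →
          (C , ∈interior (vertex⇒generic v≐) v≐ (λ _ crit → crit) (λ _ crit → crit))
        , λ D D∈ → let D∈° = interior⊆relativeInterior D∈ in
            generic-⊑ (relativeInterior⇒⊒ v≐ D∈°) (vertex⇒generic v≐)
          , relativeInterior⇒M⋆ v≐ D∈°)
    , (λ C gen → vertexOf C gen
               , ∈interior gen (generic-face gen) (λ _ crit → crit) (λ _ crit → crit)))
  , ( faceMaxoid
    , (λ (F , (_ , C , F≐) , dim) →
          (C , ∈relativeInterior F≐ (λ _ crit → crit) (λ _ crit → crit))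
        , λ D D∈ →
            -- Genericity of `D` would pass to `C`, whose critical paths are among those of `D`.
            (λ gen → positiveDimension⇒¬generic F≐ dim (generic-⊑ (∈N⇒⊑ F≐ (proj₁ D∈)) gen))
          , relativeInterior⇒M⋆ F≐ D∈)
    , (λ C ¬gen → faceOf C ¬gen
                , ∈relativeInterior ≐-refl (λ _ crit → crit) (λ _ crit → crit)))
  where
  open NormalCones ℝ G
  open CriticalPaths ℝ G
  open ConvexGeometry ℝ (DAG.#E G)
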